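{- Let $K=\mathbb{Q}(\sqrt{d})$ with $d>1$ a square-free positive integer. Then $K$ is unit reducible if and only if $d$ is of one of the following types: (T1) $d=m^2+1$ with $m\in\mathbb{N}$ odd; (T2) $d=m^2-1$ with $m\in\mathbb{N}$ even; (T3) $d=m^2+4$ with $m\in\mathbb{N}$ odd; (T4) $d=m^2-4$ with $m\in\mathbb{N}$ odd and $m>3$.
   Context: For a totally real number field $K$ with ring of integers $\mathcal{O}_K$ and unit group $\mathcal{O}_K^\times$, let $K_{>>0}$ be the set of totally positive elements and, for $a\in K_{>>0}$, $\mu(a)=\min_{x\in\mathcal{O}_K\setminus\{0\}}\mathrm{Tr}_{K/\mathbb{Q}}(ax^2)$. $K$ is called unit reducible if $\mu(a)=\min_{u\in\mathcal{O}_K^\times}\mathrm{Tr}_{K/\mathbb{Q}}(au^2)$ for all $a\in K_{>>0}$. -}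

module Defs where

open import Data.Integer.Base as ℤ using (ℤ; +_)
open import Data.List.Base using (List; []; _∷_)
open import Data.Nat.Base as ℕ using (ℕ)
open import Data.Nat.Divisibility using (_∣_)
open import Data.Product.Base using (∃; ∃₂; _×_)
open import Data.Rational.Base using (ℚ; 0ℚ; 1ℚ; _/_; _+_; _*_; -_; _<_; _≤_)
open import Data.Sum.Base using (_⊎_)
open import Relation.Binary.PropositionalEquality.Core using (_≡_; _≢_)

SquareFree : ℕ → Set
SquareFree n = ∀ k → k ℕ.* k ∣ n → k ≡ 1

fromℕ : ℕ → ℚ
fromℕ n = + n / 1

fromℤ : ℤ → ℚ
fromℤ i = i / 1

-- ⟨ p , q ⟩ stands for p + q √d.  This is a field exactly when d is not a
-- perfect square, e.g. when d > 1 is square-free.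
record ℚ[√_] (d : ℕ) : Set where
  constructor ⟨_,_⟩
  field
    rat irr : ℚ

open ℚ[√_] public

module _ {d : ℕ} where

  infixl 6 _+ᴷ_
  infixl 7 _*ᴷ_

  ι : ℚ → ℚ[√ d ]
  ι p = ⟨ p , 0ℚ ⟩

  0ᴷ 1ᴷ √d : ℚ[√ d ]
  0ᴷ = ι 0ℚ
  1ᴷ = ι 1ℚ
  √d = ⟨ 0ℚ , 1ℚ ⟩

  _+ᴷ_ _*ᴷ_ : ℚ[√ d ] → ℚ[√ d ] → ℚ[√ d ]
  ⟨ p , q ⟩ +ᴷ ⟨ r , s ⟩ = ⟨ p + r , q + s ⟩
  ⟨ p , q ⟩ *ᴷ ⟨ r , s ⟩ = ⟨ p * r + fromℕ d * (q * s) , p * s + q * r ⟩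

  -- The trace of the ℚ-linear map y ↦ x y, read off in the basis 1, √d.
  Tr : ℚ[√ d ] → ℚ
  Tr x = rat (x *ᴷ 1ᴷ) + irr (x *ᴷ √d)

  -- The value at x of the monic polynomial
  -- c₀ + c₁ X + ⋯ + cₙ₋₁ Xⁿ⁻¹ + Xⁿ with list of coefficients c₀ ∷ ⋯ ∷ cₙ₋₁ ∷ [].
  evalMonic : List ℤ → ℚ[√ d ] → ℚ[√ d ]
  evalMonic []       x = 1ᴷ
  evalMonic (c ∷ cs) x = ι (fromℤ c) +ᴷ x *ᴷ evalMonic cs x

  Integral : ℚ[√ d ] → Set
  Integral x = ∃ λ cs → evalMonic cs x ≡ 0ᴷ

  NonZeroInteger : ℚ[√ d ] → Set
  NonZeroInteger x = Integral x × x ≢ 0ᴷ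

  IntegralUnit : ℚ[√ d ] → Set
  IntegralUnit u = Integral u × ∃ λ v → Integral v × u *ᴷ v ≡ 1ᴷ

-- The Dedekind cut of the positive real number √d.
Below√ Above√ : ℕ → ℚ → Set
Below√ d l = l < 0ℚ ⊎ l * l < fromℕ d
Above√ d u = 0ℚ < u × fromℕ d < u * u

-- The lower Dedekind cut of the real number p + q √d: by monotonicity, the
-- infimum of t ↦ p + q t over an interval is the smaller of the two values at
-- its end points, and the real number p + q √d is the supremum of these infima
-- over all rational intervals around √d.
LowerCut : ℕ → ℚ → ℚ → ℚ → Set
LowerCut d p q r =
  ∃₂ λ l u → Below√ d l × Above√ d u × r < p + q * l × r < p + q * u

-- The two embeddings into ℝ send √d to √d and to − √d.
TotallyPositive : ∀ {d} → ℚ[√ d ] → Set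
TotallyPositive {d} ⟨ p , q ⟩ = LowerCut d p q 0ℚ × LowerCut d p (- q) 0ℚ

IsMinimumOver : {A : Set} → (A → Set) → (A → ℚ) → ℚ → Set
IsMinimumOver P f m = (∃ λ x → P x × f x ≡ m) × (∀ x → P x → m ≤ f x)

-- The minimum μ(a) is not a function of a without a proof that it is attained,
-- so the equality of the two minima is stated as: both exist and have the same
-- value.
UnitReducible : ℕ → Set
UnitReducible d = ∀ (a : ℚ[√ d ]) → TotallyPositive a →
  ∃ λ μ → IsMinimumOver NonZeroInteger (λ x → Tr (a *ᴷ (x *ᴷ x))) μ
        × IsMinimumOver IntegralUnit   (λ u → Tr (a *ᴷ (u *ᴷ u))) μ

{-# OPTIONS --safe #-}

-- An integral x has integral norm and trace: the powers of x have a common denominator, while squaring x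
-- squares the denominators of its norm and trace.
--
-- Direction ⇒.  Let k = 1 or 2 be such that the integers are of the form (M + N√d)/k, and let m be
-- nearest to √d among the numbers for which x = (m + √d)/k is an integer.  As a moves away from the
-- rationals, x is the first integer whose value Tr (ax²) drops below that of ±1, and for a suitable a
-- shortly after that moment every unit (M + N√d)/k with value at most that of x has N = ±1.  Since the
-- minimum is attained at a unit, M² − d = ±k² for some M.
--
-- Direction ⇐.  The integers are ℤ[ε] for the unit ε = (m + √d)/k.  Multiply a by squares of units until
-- neither ε nor ε̄ has a smaller value than 1.  The form Tr (a(K + Nε)²) is then a convex combination of
-- two forms for which the minimum is clearly attained at 1.
module Submission where

open import Defs
open import Data.Empty using (⊥; ⊥-elim)
open import Data.Integer.Base as ℤ using (ℤ; +_)
open import Data.Integer.DivMod using (a≡a%ℕn+[a/ℕn]*n; n%ℕd<d; _%ℕ_; _/ℕ_)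
import Data.Integer.Properties as ℤ
open import Data.Integer.Tactic.RingSolver using (solve-∀)
open import Data.List.Base using ([]; _∷_; length)
open import Data.Nat.Base as ℕ using (ℕ; suc; zero; s≤s; z≤n)
open import Data.Nat.Coprimality as Coprimality using (Coprime; coprime-divisor)
open import Data.Nat.Divisibility using (_∣_; _∣?_; divides; ∣⇒≤; ∣-trans)
open import Data.Nat.DivMod using (m≡m%n+[m/n]*n; m%n<n; _%_; _/_)
import Data.Nat.Properties as ℕ
open import Data.Nat.Tactic.RingSolver using () renaming (solve-∀ to solve-∀ᴺ)
open import Data.Product.Base as Product using (∃; ∃₂; _×_; _,_; proj₁; proj₂)
open import Data.Rational.Base
  using (ℚ; mkℚ; 0ℚ; 1ℚ; ½; _+_; _*_; -_; _-_; _<_; _≤_; 1/_; toℚᵘ; ↥_; ↧_; ↧ₙ_; positive; nonNegative;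
    nonPositive)
open import Data.Rational.Properties
open import Data.Rational.Solver using (module +-*-Solver)
open import Data.Rational.Unnormalised.Base as ℚᵘ using (mkℚᵘ; *≡*; *≤*; *<*)
import Data.Rational.Unnormalised.Properties as ℚᵘ
open import Data.Sum.Base using (_⊎_; inj₁; inj₂; [_,_]′)
open import Function.Base using (_∘_)
open import Function.Bundles using (_⇔_; mk⇔)
open import Relation.Binary.PropositionalEquality
  using (_≡_; _≢_; refl; sym; trans; cong; cong₂; subst; subst₂; module ≡-Reasoning)
open import Relation.Nullary.Decidable.Core using (Dec; yes; no; from-no)
open import Relation.Nullary.Negation.Core using (¬_; contradiction)

open +-*-Solver using (solve; _:=_; _:+_; _:*_; _:-_; :-_; con)

-- Direction ⇒ has no access to a fundamental unit, so units are controlled by size alone. The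
-- element a is normalised so that x has exactly half the value of 1, which rules out units with N =
-- 0; the nearness of m to √d keeps the discriminant of the form so large that N² ≤ 2.
--
-- In direction ⇐ the multiplication by squares of units stops because the values Tr (au²) are
-- nonnegative and share one denominator. In the norm 1 case the two extreme forms are equivalent to
-- tK² + 4KN + tN², where t is the trace of ε. Its value at (1, -1) is 2t - 4, so (1, 0) can be
-- minimal only if t ≥ 4. This is the origin of m > 3 in the last type: for m = 3 the unit (3 +
-- √5)/2 fails as a generator of the reduction, and d = 5 is covered instead by (1 + √5)/2, of norm
-- -1.

-- Integers inside the rationals, and sign rules.

toℚᵘ-fromℤ : ∀ i → toℚᵘ (fromℤ i) ℚᵘ.≃ mkℚᵘ i 0
toℚᵘ-fromℤ i = toℚᵘ-fromℚᵘ (mkℚᵘ i 0)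

fromℤ-homo-+ : ∀ i j → fromℤ (i ℤ.+ j) ≡ fromℤ i + fromℤ j
fromℤ-homo-+ i j = toℚᵘ-injective (begin
  toℚᵘ (fromℤ (i ℤ.+ j))               ≈⟨ toℚᵘ-fromℤ (i ℤ.+ j) ⟩
  mkℚᵘ (i ℤ.+ j) 0                     ≈⟨ *≡* (lemma i j) ⟩
  mkℚᵘ i 0 ℚᵘ.+ mkℚᵘ j 0               ≈⟨ ℚᵘ.+-cong (toℚᵘ-fromℤ i) (toℚᵘ-fromℤ j) ⟨
  toℚᵘ (fromℤ i) ℚᵘ.+ toℚᵘ (fromℤ j)   ≈⟨ toℚᵘ-homo-+ (fromℤ i) (fromℤ j) ⟨
  toℚᵘ (fromℤ i + fromℤ j)             ∎)
  where
  open ℚᵘ.≃-Reasoning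
  lemma : ∀ i j → (i ℤ.+ j) ℤ.* ℤ.1ℤ ≡ (i ℤ.* ℤ.1ℤ ℤ.+ j ℤ.* ℤ.1ℤ) ℤ.* ℤ.1ℤ
  lemma = solve-∀

fromℤ-homo-* : ∀ i j → fromℤ (i ℤ.* j) ≡ fromℤ i * fromℤ j
fromℤ-homo-* i j = toℚᵘ-injective (begin
  toℚᵘ (fromℤ (i ℤ.* j))               ≈⟨ toℚᵘ-fromℤ (i ℤ.* j) ⟩
  mkℚᵘ i 0 ℚᵘ.* mkℚᵘ j 0               ≈⟨ ℚᵘ.*-cong (toℚᵘ-fromℤ i) (toℚᵘ-fromℤ j) ⟨
  toℚᵘ (fromℤ i) ℚᵘ.* toℚᵘ (fromℤ j)   ≈⟨ toℚᵘ-homo-* (fromℤ i) (fromℤ j) ⟨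
  toℚᵘ (fromℤ i * fromℤ j)             ∎)
  where open ℚᵘ.≃-Reasoning

fromℤ-homo-neg : ∀ i → fromℤ (ℤ.- i) ≡ - fromℤ i
fromℤ-homo-neg i = toℚᵘ-injective (begin
  toℚᵘ (fromℤ (ℤ.- i))   ≈⟨ toℚᵘ-fromℤ (ℤ.- i) ⟩
  ℚᵘ.- mkℚᵘ i 0          ≈⟨ ℚᵘ.-‿cong (toℚᵘ-fromℤ i) ⟨
  ℚᵘ.- toℚᵘ (fromℤ i)    ≈⟨ toℚᵘ-homo‿- (fromℤ i) ⟨
  toℚᵘ (- fromℤ i)       ∎)
  where open ℚᵘ.≃-Reasoning

fromℤ-homo-- : ∀ i j → fromℤ (i ℤ.- j) ≡ fromℤ i - fromℤ j
fromℤ-homo-- i j = trans (fromℤ-homo-+ i (ℤ.- j)) (cong (λ x → fromℤ i + x) (fromℤ-homo-neg j))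

fromℤ-injective : ∀ {i j} → fromℤ i ≡ fromℤ j → i ≡ j
fromℤ-injective {i} {j} eq with *≡* h ← fromℚᵘ-injective {mkℚᵘ i 0} {mkℚᵘ j 0} eq =
  ℤ.*-cancelʳ-≡ i j ℤ.1ℤ h

fromℤ-mono-≤ : ∀ {i j} → i ℤ.≤ j → fromℤ i ≤ fromℤ j
fromℤ-mono-≤ {i} {j} i≤j = toℚᵘ-cancel-≤ (begin
  toℚᵘ (fromℤ i)   ≃⟨ toℚᵘ-fromℤ i ⟩
  mkℚᵘ i 0         ≤⟨ *≤* (ℤ.*-monoʳ-≤-nonNeg ℤ.1ℤ i≤j) ⟩
  mkℚᵘ j 0         ≃⟨ toℚᵘ-fromℤ j ⟨
  toℚᵘ (fromℤ j)   ∎)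
  where open ℚᵘ.≤-Reasoning

fromℤ-mono-< : ∀ {i j} → i ℤ.< j → fromℤ i < fromℤ j
fromℤ-mono-< {i} {j} i<j = toℚᵘ-cancel-< (begin-strict
  toℚᵘ (fromℤ i)   ≃⟨ toℚᵘ-fromℤ i ⟩
  mkℚᵘ i 0         <⟨ *<* (ℤ.*-monoʳ-<-pos ℤ.1ℤ i<j) ⟩
  mkℚᵘ j 0         ≃⟨ toℚᵘ-fromℤ j ⟨
  toℚᵘ (fromℤ j)   ∎)
  where open ℚᵘ.≤-Reasoning

fromℤ-cancel-≤ : ∀ {i j} → fromℤ i ≤ fromℤ j → i ℤ.≤ j
fromℤ-cancel-≤ p = ℤ.≮⇒≥ λ j<i → <-irrefl refl (<-≤-trans (fromℤ-mono-< j<i) p)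

fromℤ-cancel-< : ∀ {i j} → fromℤ i < fromℤ j → i ℤ.< j
fromℤ-cancel-< p = ℤ.≰⇒> λ j≤i → <-irrefl refl (<-≤-trans p (fromℤ-mono-≤ j≤i))

fromℤ-↥ : ∀ r → fromℤ (↥ r) ≡ r * fromℤ (↧ r)
fromℤ-↥ r@(mkℚ a b-1 _) = toℚᵘ-injective (begin
  toℚᵘ (fromℤ a)                   ≈⟨ toℚᵘ-fromℤ a ⟩
  mkℚᵘ a 0                         ≈⟨ *≡* (lemma a (+ suc b-1)) ⟩
  toℚᵘ r ℚᵘ.* mkℚᵘ (+ suc b-1) 0   ≈⟨ ℚᵘ.*-congˡ {toℚᵘ r} (toℚᵘ-fromℤ (+ suc b-1)) ⟨
  toℚᵘ r ℚᵘ.* toℚᵘ (fromℤ (↧ r))   ≈⟨ toℚᵘ-homo-* r (fromℤ (↧ r)) ⟨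
  toℚᵘ (r * fromℤ (↧ r))           ∎)
  where
  open ℚᵘ.≃-Reasoning
  lemma : ∀ i j → i ℤ.* (j ℤ.* ℤ.1ℤ) ≡ (i ℤ.* j) ℤ.* ℤ.1ℤ
  lemma = solve-∀

0<fromℤ↧ : ∀ r → 0ℚ < fromℤ (↧ r)
0<fromℤ↧ r = fromℤ-mono-< {ℤ.0ℤ} (ℤ.positive⁻¹ (↧ r))

0≤* : ∀ {x y} → 0ℚ ≤ x → 0ℚ ≤ y → 0ℚ ≤ x * y
0≤* {x} {y} p q = nonNegative⁻¹ (x * y) {{nonNeg*nonNeg⇒nonNeg x {{nonNegative p}} y {{nonNegative q}}}}

0<* : ∀ {x y} → 0ℚ < x → 0ℚ < y → 0ℚ < x * y
0<* {x} {y} p q = positive⁻¹ (x * y) {{pos*pos⇒pos x {{positive p}} y {{positive q}}}}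

0≤+ : ∀ {x y} → 0ℚ ≤ x → 0ℚ ≤ y → 0ℚ ≤ x + y
0≤+ = +-mono-≤

0<+ : ∀ {x y} → 0ℚ < x → 0ℚ ≤ y → 0ℚ < x + y
0<+ = +-mono-<-≤

0≤² : ∀ x → 0ℚ ≤ x * x
0≤² x with ≤-total 0ℚ x
... | inj₁ 0≤x = 0≤* 0≤x 0≤x
... | inj₂ x≤0 = nonNegative⁻¹ (x * x)
  {{nonPos*nonPos⇒nonPos x {{nonPositive x≤0}} x {{nonPositive x≤0}}}}

0≤*⇒0≤ : ∀ {c x} → 0ℚ < c → 0ℚ ≤ c * x → 0ℚ ≤ x
0≤*⇒0≤ {c} {x} 0<c p = *-cancelˡ-≤-pos c {{positive 0<c}} (subst (_≤ c * x) (sym (*-zeroʳ c)) p)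

0<*⇒0< : ∀ {c x} → 0ℚ ≤ c → 0ℚ < c * x → 0ℚ < x
0<*⇒0< {c} {x} 0≤c p = *-cancelˡ-<-nonNeg c {{nonNegative 0≤c}} (subst (_< c * x) (sym (*-zeroʳ c)) p)

+-minus : ∀ x y → x + (y - x) ≡ y
+-minus = solve 2 (λ x y → x :+ (y :- x) := y) refl

≤⇒0≤- : ∀ {x y} → x ≤ y → 0ℚ ≤ y - x
≤⇒0≤- {x} {y} p = subst (_≤ y - x) (+-inverseʳ x) (+-monoˡ-≤ (- x) p)

<⇒0<- : ∀ {x y} → x < y → 0ℚ < y - x
<⇒0<- {x} {y} p = subst (_< y - x) (+-inverseʳ x) (+-monoˡ-< (- x) p)

0≤-⇒≤ : ∀ {x y} → 0ℚ ≤ y - x → x ≤ y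
0≤-⇒≤ {x} {y} p = subst₂ _≤_ (+-identityʳ x) (+-minus x y) (+-monoʳ-≤ x p)

0<-⇒< : ∀ {x y} → 0ℚ < y - x → x < y
0<-⇒< {x} {y} p = subst₂ _<_ (+-identityʳ x) (+-minus x y) (+-monoʳ-< x p)

neg-involutive : ∀ x → - (- x) ≡ x
neg-involutive = solve 1 (λ x → :- (:- x) := x) refl

-- Integral rationals and their denominators.

record Integer (r : ℚ) : Set where
  constructor _,_
  field
    value    : ℤ
    equality : r ≡ fromℤ value

open Integer public

integer-fromℤ : ∀ i → Integer (fromℤ i)
integer-fromℤ i = i , refl

integer-+ : ∀ {r s} → Integer r → Integer s → Integer (r + s)
integer-+ (i , refl) (j , refl) = i ℤ.+ j , sym (fromℤ-homo-+ i j)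

integer-* : ∀ {r s} → Integer r → Integer s → Integer (r * s)
integer-* (i , refl) (j , refl) = i ℤ.* j , sym (fromℤ-homo-* i j)

integer-- : ∀ {r s} → Integer r → Integer s → Integer (r - s)
integer-- (i , refl) (j , refl) = i ℤ.- j , sym (fromℤ-homo-- i j)

↧≡1⇒integer : ∀ r → ↧ₙ r ≡ 1 → Integer r
↧≡1⇒integer r eq = ↥ r , (begin
  r                 ≡⟨ *-identityʳ r ⟨
  r * 1ℚ            ≡⟨ cong (λ n → r * fromℕ n) eq ⟨
  r * fromℤ (↧ r)   ≡⟨ fromℤ-↥ r ⟨
  fromℤ (↥ r)       ∎)
  where open ≡-Reasoning

coprime-*ˡ : ∀ {m n k} → Coprime m k → Coprime n k → Coprime (m ℕ.* n) k
coprime-*ˡ {m} {n} {k} mk nk {i} (i∣mn , i∣k) = nk (coprime-divisor im i∣mn , i∣k)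
  where
  im : Coprime i m
  im (j∣i , j∣m) = mk (j∣m , ∣-trans j∣i i∣k)

coprime-² : ∀ {m n} → Coprime m n → Coprime (m ℕ.* m) (n ℕ.* n)
coprime-² c = coprime-*ˡ {k = _} c' c'
  where c' = Coprimality.sym (coprime-*ˡ (Coprimality.sym c) (Coprimality.sym c))

clear-² : ∀ c r b → c * (r * r) * (b * b) ≡ c * ((r * b) * (r * b))
clear-² = solve 3 (λ c r b → c :* (r :* r) :* (b :* b) := c :* ((r :* b) :* (r :* b))) refl

-- In lowest terms, the denominator of c r² can only be absorbed by c.
↧²∣ : ∀ c r → Integer (fromℤ c * (r * r)) → ↧ₙ r ℕ.* ↧ₙ r ∣ ℤ.∣ c ∣
↧²∣ c r@(mkℚ a b-1 cop) (z , eq) = coprime-divisor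
  (coprime-² (Coprimality.sym (Coprimality.recompute cop)))
  (divides ℤ.∣ z ∣ (begin
    A ℕ.* A ℕ.* ℤ.∣ c ∣                 ≡⟨ ℕ.*-comm (A ℕ.* A) ℤ.∣ c ∣ ⟩
    ℤ.∣ c ∣ ℕ.* (A ℕ.* A)               ≡⟨ cong (ℤ.∣ c ∣ ℕ.*_) (ℤ.abs-* a a) ⟨
    ℤ.∣ c ∣ ℕ.* ℤ.∣ a ℤ.* a ∣           ≡⟨ ℤ.abs-* c (a ℤ.* a) ⟨
    ℤ.∣ c ℤ.* (a ℤ.* a) ∣               ≡⟨ cong ℤ.∣_∣ ca²≡zb² ⟩
    ℤ.∣ z ℤ.* (b ℤ.* b) ∣               ≡⟨ ℤ.abs-* z (b ℤ.* b) ⟩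
    ℤ.∣ z ∣ ℕ.* (↧ₙ r ℕ.* ↧ₙ r)         ∎))
  where
  open ≡-Reasoning
  A = ℤ.∣ a ∣
  b = ↧ r
  ca²≡zb² : c ℤ.* (a ℤ.* a) ≡ z ℤ.* (b ℤ.* b)
  ca²≡zb² = fromℤ-injective (begin
    fromℤ (c ℤ.* (a ℤ.* a))                       ≡⟨ fromℤ-homo-* c (a ℤ.* a) ⟩
    fromℤ c * fromℤ (a ℤ.* a)                     ≡⟨ cong (fromℤ c *_) (fromℤ-homo-* a a) ⟩
    fromℤ c * (fromℤ a * fromℤ a)                 ≡⟨ cong (λ x → fromℤ c * (x * x)) (fromℤ-↥ r) ⟩
    fromℤ c * ((r * fromℤ b) * (r * fromℤ b))     ≡⟨ clear-² (fromℤ c) r (fromℤ b) ⟨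
    fromℤ c * (r * r) * (fromℤ b * fromℤ b)       ≡⟨ cong₂ _*_ eq (sym (fromℤ-homo-* b b)) ⟩
    fromℤ z * fromℤ (b ℤ.* b)                     ≡⟨ fromℤ-homo-* z (b ℤ.* b) ⟨
    fromℤ (z ℤ.* (b ℤ.* b))                       ∎)

restore-² : ∀ c x m → c * (x - m) + c * m ≡ c * x
restore-² = solve 3 (λ c x m → c :* (x :- m) :+ c :* m := c :* x) refl

-- The denominator is squared at every step, so if it stays bounded it is 1.
bounded-squares⇒integer : (r : ℕ → ℚ) (m : ℕ → ℤ) (D : ℤ) .{{_ : ℤ.NonZero D}} →
  (∀ j → r (suc j) ≡ r j * r j - fromℤ (m j)) → (∀ j → Integer (fromℤ D * r j)) → Integer (r 0)
bounded-squares⇒integer r m D step bounded with ↧ₙ (r 0) in eq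
... | suc zero = ↧≡1⇒integer (r 0) eq
... | suc (suc b) = contradiction too-big (ℕ.<⇒≱ (ℕ.<-trans (ℕ.n<1+n _) (grow ℤ.∣ D ∣)))
  where
  -- Adding back c times the integer `m j` turns c · `r (suc j)` into c · `r j`², to which `↧²∣`
  -- applies.
  square∣ : ∀ j c → Integer (fromℤ c * r (suc j)) → ↧ₙ (r j) ℕ.* ↧ₙ (r j) ∣ ℤ.∣ c ∣
  square∣ j c int = ↧²∣ c (r j) (subst Integer
    (trans (cong (λ x → fromℤ c * x + fromℤ c * fromℤ (m j)) (step j))
           (restore-² (fromℤ c) (r j * r j) (fromℤ (m j))))
    (integer-+ int (integer-* (integer-fromℤ c) (integer-fromℤ (m j)))))

  grow : ∀ j → 1 ℕ.+ j ℕ.< ↧ₙ (r j)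
  grow zero = subst (1 ℕ.<_) (sym eq) (s≤s (s≤s z≤n))
  grow (suc j) = begin-strict
    2 ℕ.+ j                       ≤⟨ grow j ⟩
    ↧ₙ (r j)                      <⟨ ℕ.m<m*n (↧ₙ (r j)) (↧ₙ (r j)) (ℕ.≤-<-trans (s≤s z≤n) (grow j)) ⟩
    ↧ₙ (r j) ℕ.* ↧ₙ (r j)         ≤⟨ ∣⇒≤ (square∣ j (↧ (r (suc j))) (↥ (r (suc j)) , trans
                                       (*-comm (fromℤ (↧ (r (suc j)))) (r (suc j)))
                                       (sym (fromℤ-↥ (r (suc j)))))) ⟩
    ↧ₙ (r (suc j))                ∎
    where open ℕ.≤-Reasoning

  -- Index |D| is late enough: `grow` pushes this denominator above |D| + 1, while its square
  -- divides |D|.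
  too-big : ↧ₙ (r ℤ.∣ D ∣) ℕ.≤ ℤ.∣ D ∣
  too-big = ℕ.≤-trans (ℕ.m≤m*n (↧ₙ (r ℤ.∣ D ∣)) (↧ₙ (r ℤ.∣ D ∣))) (∣⇒≤ (square∣ ℤ.∣ D ∣ D (bounded _)))

-- Ring laws and the norm in ℚ(√d).

module _ {d : ℕ} where

  infixr 8 _^ᴷ_

  _^ᴷ_ : ℚ[√ d ] → ℕ → ℚ[√ d ]
  x ^ᴷ zero  = 1ᴷ
  x ^ᴷ suc k = x *ᴷ (x ^ᴷ k)

  norm : ℚ[√ d ] → ℚ
  norm ⟨ p , q ⟩ = p * p - fromℕ d * (q * q)

mul-comm-rat : ∀ d p q r s → p * r + d * (q * s) ≡ r * p + d * (s * q)
mul-comm-rat = solve 5 (λ d p q r s → p :* r :+ d :* (q :* s) := r :* p :+ d :* (s :* q)) refl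

mul-comm-irr : ∀ p q r s → p * s + q * r ≡ r * q + s * p
mul-comm-irr = solve 4 (λ p q r s → p :* s :+ q :* r := r :* q :+ s :* p) refl

mul-assoc-rat : ∀ d p q r s t u →
  (p * r + d * (q * s)) * t + d * ((p * s + q * r) * u) ≡ p * (r * t + d * (s * u)) + d *
    (q * (r * u + s * t))
mul-assoc-rat = solve 7 (λ d p q r s t u → (p :* r :+ d :* (q :* s)) :* t :+ d :* ((p :* s :+ q :*
  r) :* u) := p :* (r :* t :+ d :* (s :* u)) :+ d :* (q :* (r :* u :+ s :* t))) refl

mul-assoc-irr : ∀ d p q r s t u →
  (p * r + d * (q * s)) * u + (p * s + q * r) * t ≡ p * (r * u + s * t) + q * (r * t + d * (s * u))
mul-assoc-irr = solve 7 (λ d p q r s t u → (p :* r :+ d :* (q :* s)) :* u :+ (p :* s :+ q :* r) :* t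
  := p :* (r :* u :+ s :* t) :+ q :* (r :* t :+ d :* (s :* u))) refl

mul-one-rat : ∀ d p q → 1ℚ * p + d * (0ℚ * q) ≡ p
mul-one-rat = solve 3 (λ d p q → con 1ℚ :* p :+ d :* (con 0ℚ :* q) := p) refl

mul-one-irr : ∀ p q → 1ℚ * q + 0ℚ * p ≡ q
mul-one-irr = solve 2 (λ p q → con 1ℚ :* q :+ con 0ℚ :* p := q) refl

mul-zero-rat : ∀ d p q → 0ℚ * p + d * (0ℚ * q) ≡ 0ℚ
mul-zero-rat = solve 3 (λ d p q → con 0ℚ :* p :+ d :* (con 0ℚ :* q) := con 0ℚ) refl

mul-zero-irr : ∀ p q → 0ℚ * q + 0ℚ * p ≡ 0ℚ
mul-zero-irr = solve 2 (λ p q → con 0ℚ :* q :+ con 0ℚ :* p := con 0ℚ) refl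

norm-homo-* : ∀ {d} (x y : ℚ[√ d ]) → norm (x *ᴷ y) ≡ norm x * norm y
norm-homo-* {d} ⟨ p , q ⟩ ⟨ r , s ⟩ = lemma (fromℕ d) p q r s
  where
  lemma : ∀ d p q r s →
    (p * r + d * (q * s)) * (p * r + d * (q * s)) - d * ((p * s + q * r) * (p * s + q * r))
    ≡ (p * p - d * (q * q)) * (r * r - d * (s * s))
  lemma = solve 5 (λ d p q r s → (p :* r :+ d :* (q :* s)) :* (p :* r :+ d :* (q :* s)) :- d :* ((p
    :* s :+ q :* r) :* (p :* s :+ q :* r)) := (p :* p :- d :* (q :* q)) :* (r :* r :- d :* (s :*
    s))) refl

module _ {d : ℕ} where

  *ᴷ-comm : (x y : ℚ[√ d ]) → x *ᴷ y ≡ y *ᴷ x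
  *ᴷ-comm ⟨ p , q ⟩ ⟨ r , s ⟩ = cong₂ ⟨_,_⟩ (mul-comm-rat (fromℕ d) p q r s) (mul-comm-irr p q r s)

  *ᴷ-assoc : (x y z : ℚ[√ d ]) → (x *ᴷ y) *ᴷ z ≡ x *ᴷ (y *ᴷ z)
  *ᴷ-assoc ⟨ p , q ⟩ ⟨ r , s ⟩ ⟨ t , u ⟩ =
    cong₂ ⟨_,_⟩ (mul-assoc-rat (fromℕ d) p q r s t u) (mul-assoc-irr (fromℕ d) p q r s t u)

  *ᴷ-identityˡ : (x : ℚ[√ d ]) → 1ᴷ *ᴷ x ≡ x
  *ᴷ-identityˡ ⟨ p , q ⟩ = cong₂ ⟨_,_⟩ (mul-one-rat (fromℕ d) p q) (mul-one-irr p q)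

  *ᴷ-zeroˡ : (x : ℚ[√ d ]) → 0ᴷ *ᴷ x ≡ 0ᴷ
  *ᴷ-zeroˡ ⟨ p , q ⟩ = cong₂ ⟨_,_⟩ (mul-zero-rat (fromℕ d) p q) (mul-zero-irr p q)

  square-^ᴷ : (x : ℚ[√ d ]) → ∀ k → (x *ᴷ x) ^ᴷ k ≡ x ^ᴷ (k ℕ.+ k)
  square-^ᴷ x zero    = refl
  square-^ᴷ x (suc k) = begin
    (x *ᴷ x) *ᴷ (x *ᴷ x) ^ᴷ k   ≡⟨ cong ((x *ᴷ x) *ᴷ_) (square-^ᴷ x k) ⟩
    (x *ᴷ x) *ᴷ x ^ᴷ (k ℕ.+ k)  ≡⟨ *ᴷ-assoc x x _ ⟩
    x ^ᴷ suc (suc (k ℕ.+ k))    ≡⟨ cong (λ n → x ^ᴷ suc n) (ℕ.+-suc k k) ⟨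
    x ^ᴷ (suc k ℕ.+ suc k)      ∎
    where open ≡-Reasoning

  -- z ∈ (1/D) ℤ[√d]
  Bounded : ℤ → ℚ[√ d ] → Set
  Bounded D z = Integer (fromℤ D * rat z) × Integer (fromℤ D * irr z)

-- A common denominator for all powers of an integral element.

bounded-eval-rat : ∀ D d c e f p q →
  D * ((c + e) * p + d * ((0ℚ + f) * q)) - c * (D * p) ≡ D * (e * p + d * (f * q))
bounded-eval-rat = solve 7 (λ D d c e f p q → D :* ((c :+ e) :* p :+ d :* ((con 0ℚ :+ f) :* q)) :- c
  :* (D :* p) := D :* (e :* p :+ d :* (f :* q))) refl

bounded-eval-irr : ∀ D c e f p q → D * ((c + e) * q + (0ℚ + f) * p) - c * (D * q) ≡ D * (e * q + f * p)
bounded-eval-irr = solve 6 (λ D c e f p q → D :* ((c :+ e) :* q :+ (con 0ℚ :+ f) :* p) :- c :* (D :*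
  q) := D :* (e :* q :+ f :* p)) refl

bounded-mul-rat : ∀ δ D d p q r s → δ * p * (D * r) + d * (δ * q * (D * s))
  ≡ δ * D * (p * r + d * (q * s))
bounded-mul-rat = solve 7 (λ δ D d p q r s → δ :* p :* (D :* r) :+ d :* (δ :* q :* (D :* s)) := δ :*
  D :* (p :* r :+ d :* (q :* s))) refl

bounded-mul-irr : ∀ δ D p q r s → δ * p * (D * s) + δ * q * (D * r) ≡ δ * D * (p * s + q * r)
bounded-mul-irr = solve 6 (λ δ D p q r s → δ :* p :* (D :* s) :+ δ :* q :* (D :* r) := δ :* D :* (p
  :* s :+ q :* r)) refl

module _ {d : ℕ} where

  bounded-*ᴷ : ∀ δ D (x z : ℚ[√ d ]) → Bounded δ x → Bounded D z → Bounded (δ ℤ.* D) (x *ᴷ z)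
  bounded-*ᴷ δ D ⟨ p , q ⟩ ⟨ r , s ⟩ (p∈ , q∈) (r∈ , s∈) =
    subst Integer (trans (bounded-mul-rat (fromℤ δ) (fromℤ D) (fromℕ d) p q r s)
                         (cong (_* (p * r + fromℕ d * (q * s))) (sym (fromℤ-homo-* δ D))))
      (integer-+ (integer-* p∈ r∈) (integer-* (integer-fromℤ (+ d)) (integer-* q∈ s∈))) ,
    subst Integer (trans (bounded-mul-irr (fromℤ δ) (fromℤ D) p q r s)
                         (cong (_* (p * s + q * r)) (sym (fromℤ-homo-* δ D))))
      (integer-+ (integer-* p∈ s∈) (integer-* q∈ r∈))

  bounded-1ᴷ : ∀ D → Bounded {d} D 1ᴷ
  bounded-1ᴷ D = (D , *-identityʳ (fromℤ D)) , (ℤ.0ℤ , *-zeroʳ (fromℤ D))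

  bounded-0ᴷ : ∀ D → Bounded {d} D 0ᴷ
  bounded-0ᴷ D = (ℤ.0ℤ , *-zeroʳ (fromℤ D)) , (ℤ.0ℤ , *-zeroʳ (fromℤ D))

  -- Horner's scheme peels off the constant coefficient: z is bounded, so c z can be subtracted from
  -- (c + x E) z, leaving E (x z). This is the same claim for a shorter list with x z in place of z,
  -- which is why the multiplier z is kept general.
  bounded-eval : ∀ D cs (x z : ℚ[√ d ]) → (∀ k → k ℕ.< length cs → Bounded D (x ^ᴷ k *ᴷ z)) →
    Bounded D (evalMonic cs x *ᴷ z) → Bounded D (x ^ᴷ length cs *ᴷ z)
  bounded-eval D []       x z low top = top
  bounded-eval D (c ∷ cs) x z low top = subst (Bounded D) (shift (length cs))
    (bounded-eval D cs x (x *ᴷ z) (λ k k< → subst (Bounded D) (sym (shift k)) (low (suc k) (s≤s k<)))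
      (subst (Bounded D) (trans (cong (_*ᴷ z) (*ᴷ-comm x E)) (*ᴷ-assoc E x z)) tail))
    where
    E = evalMonic cs x
    shift : ∀ k → x ^ᴷ k *ᴷ (x *ᴷ z) ≡ x ^ᴷ suc k *ᴷ z
    shift k = trans (sym (*ᴷ-assoc (x ^ᴷ k) x z)) (cong (_*ᴷ z) (*ᴷ-comm (x ^ᴷ k) x))
    const : Bounded D z
    const = subst (Bounded D) (*ᴷ-identityˡ z) (low 0 (s≤s z≤n))
    tail : Bounded D ((x *ᴷ E) *ᴷ z)
    tail =
      subst Integer (bounded-eval-rat (fromℤ D) (fromℕ d) (fromℤ c) (rat (x *ᴷ E)) (irr (x *ᴷ E))
        (rat z) (irr z))
        (integer-- (proj₁ top) (integer-* (integer-fromℤ c) (proj₁ const))) ,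
      subst Integer (bounded-eval-irr (fromℤ D) (fromℤ c) (rat (x *ᴷ E)) (irr (x *ᴷ E)) (rat z) (irr z))
        (integer-- (proj₂ top) (integer-* (integer-fromℤ c) (proj₂ const)))

  denominator : ℚ[√ d ] → ℤ
  denominator x = ↧ (rat x) ℤ.* ↧ (irr x)

  bounded-denominator : ∀ x → Bounded (denominator x) x
  bounded-denominator ⟨ p , q ⟩ =
    subst Integer (trans (lemma₁ (fromℤ (↧ p)) (fromℤ (↧ q)) p)
      (cong (_* p) (sym (fromℤ-homo-* (↧ p) (↧ q)))))
      (integer-* (↥ p , sym (fromℤ-↥ p)) (integer-fromℤ (↧ q))) ,
    subst Integer (trans (lemma₂ (fromℤ (↧ p)) (fromℤ (↧ q)) q)
      (cong (_* q) (sym (fromℤ-homo-* (↧ p) (↧ q)))))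
      (integer-* (↥ q , sym (fromℤ-↥ q)) (integer-fromℤ (↧ p)))
    where
    lemma₁ : ∀ a b p → p * a * b ≡ a * b * p
    lemma₁ = solve 3 (λ a b p → p :* a :* b := a :* b :* p) refl
    lemma₂ : ∀ a b p → p * b * a ≡ a * b * p
    lemma₂ = solve 3 (λ a b p → p :* b :* a := a :* b :* p) refl

  bounded-low-powers : ∀ x n → ∀ k → k ℕ.≤ n → Bounded (denominator x ℤ.^ n) (x ^ᴷ k)
  bounded-low-powers x n       zero    _         = bounded-1ᴷ (denominator x ℤ.^ n)
  bounded-low-powers x (suc n) (suc k) (s≤s k≤n) =
    bounded-*ᴷ (denominator x) (denominator x ℤ.^ n) x (x ^ᴷ k) (bounded-denominator x)
      (bounded-low-powers x n k k≤n)

  -- With δ the denominator of x and n the degree, δⁿ clears the powers up to n, and the monic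
  -- equation makes every later power an integral combination of the n preceding ones.
  bounded-powers : ∀ {x} → Integral x → ∃ λ D → ℤ.NonZero D × (∀ k → Bounded D (x ^ᴷ k))
  bounded-powers {x} (cs , root) = D , nonZero-^ (length cs) , powers
    where
    D = denominator x ℤ.^ length cs
    nonZero-^ : ∀ n → ℤ.NonZero (denominator x ℤ.^ n)
    nonZero-^ zero    = _
    nonZero-^ (suc n) = ℤ.i*j≢0 (denominator x) (denominator x ℤ.^ n)
      {{ℤ.i*j≢0 (↧ (rat x)) (↧ (irr x))}} {{nonZero-^ n}}

    top : ∀ j → (∀ k → k ℕ.< length cs → Bounded D (x ^ᴷ k *ᴷ x ^ᴷ j)) →
      Bounded D (x ^ᴷ length cs *ᴷ x ^ᴷ j)
    top j low = bounded-eval D cs x (x ^ᴷ j) low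
      (subst (Bounded D) (sym (trans (cong (_*ᴷ x ^ᴷ j) root) (*ᴷ-zeroˡ (x ^ᴷ j)))) (bounded-0ᴷ D))

    -- The window covers the exponents j to j + n, with n the degree. Moving it up by one adds only
    -- the top exponent, which the equation multiplied by the power `suc j` supplies.
    window : ∀ j k → k ℕ.≤ length cs → Bounded D (x ^ᴷ k *ᴷ x ^ᴷ j)
    window j k k≤ with ℕ.m≤n⇒m<n∨m≡n k≤
    window zero    k k≤ | _         =
      subst (Bounded D) (trans (sym (*ᴷ-identityˡ (x ^ᴷ k))) (*ᴷ-comm 1ᴷ (x ^ᴷ k)))
                                        (bounded-low-powers x (length cs) k k≤)
    window (suc j) k _  | inj₁ k<n  = subst (Bounded D)
      (trans (cong (_*ᴷ x ^ᴷ j) (*ᴷ-comm x (x ^ᴷ k))) (*ᴷ-assoc (x ^ᴷ k) x (x ^ᴷ j)))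
        (window j (suc k) k<n)
    window (suc j) k _  | inj₂ refl = top (suc j) λ i i< → subst (Bounded D)
      (trans (cong (_*ᴷ x ^ᴷ j) (*ᴷ-comm x (x ^ᴷ i))) (*ᴷ-assoc (x ^ᴷ i) x (x ^ᴷ j)))
        (window j (suc i) i<)

    powers : ∀ k → Bounded D (x ^ᴷ k)
    powers k = subst (Bounded D) (*ᴷ-identityˡ (x ^ᴷ k)) (window k 0 z≤n)

iterated-square : ∀ {d} → ℚ[√ d ] → ℕ → ℚ[√ d ]
iterated-square x zero    = x
iterated-square x (suc j) = iterated-square x j *ᴷ iterated-square x j

iterated-square-^ᴷ : ∀ {d} (x : ℚ[√ d ]) j → ∃ λ k → iterated-square x j ≡ x ^ᴷ k
iterated-square-^ᴷ x zero = 1 , trans (sym (*ᴷ-identityˡ x)) (*ᴷ-comm 1ᴷ x)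
iterated-square-^ᴷ x (suc j) with k , eq ← iterated-square-^ᴷ x j =
  k ℕ.+ k , trans (cong₂ _*ᴷ_ eq eq) (^ᴷ-*ᴷ k)
  where
  ^ᴷ-*ᴷ : ∀ i {k} → x ^ᴷ i *ᴷ x ^ᴷ k ≡ x ^ᴷ (i ℕ.+ k)
  ^ᴷ-*ᴷ zero    = *ᴷ-identityˡ _
  ^ᴷ-*ᴷ (suc i) = trans (*ᴷ-assoc x (x ^ᴷ i) _) (cong (x *ᴷ_) (^ᴷ-*ᴷ i))

-- Integral norm and trace; half-integral coordinates.

record Coordinates {d : ℕ} (k : ℤ) (x : ℚ[√ d ]) : Set where
  field
    {a b n} : ℤ
    rat-eq  : fromℤ k * rat x ≡ fromℤ a
    irr-eq  : fromℤ k * irr x ≡ fromℤ b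
    norm-eq : norm x ≡ fromℤ n

open Coordinates

scaled-norm : ∀ k d p q → (k * p) * (k * p) ≡ d * ((k * q) * (k * q)) + k * k * (p * p - d * (q * q))
scaled-norm = solve 4 (λ k d p q → (k :* p) :* (k :* p) := d :* ((k :* q) :* (k :* q)) :+ k :* k :*
  (p :* p :- d :* (q :* q))) refl

coordinates-norm : ∀ {d k} {x : ℚ[√ d ]} (c : Coordinates k x) →
  a c ℤ.* a c ≡ + d ℤ.* (b c ℤ.* b c) ℤ.+ k ℤ.* k ℤ.* n c
coordinates-norm {d} {k} {⟨ p , q ⟩} record { a = a ; b = b ; n = n ; rat-eq = ra ; irr-eq =
  ir ; norm-eq = nm } =
  fromℤ-injective (begin
    fromℤ (a ℤ.* a)                                       ≡⟨ fromℤ-homo-* a a ⟩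
    fromℤ a * fromℤ a                                     ≡⟨ cong₂ _*_ ra ra ⟨
    (k′ * p) * (k′ * p)                                   ≡⟨ scaled-norm k′ d′ p q ⟩
    d′ * ((k′ * q) * (k′ * q)) + k′ * k′ * norm {d} ⟨ p , q ⟩
      ≡⟨ cong₂ (λ x y → d′ * (x * x) + k′ * k′ * y) ir nm ⟩
    d′ * (fromℤ b * fromℤ b) + k′ * k′ * fromℤ n          ≡⟨ cong₂ (λ x y → d′ * x + y * fromℤ n)
      (fromℤ-homo-* b b) (fromℤ-homo-* k k) ⟨
    d′ * fromℤ (b ℤ.* b) + fromℤ (k ℤ.* k) * fromℤ n      ≡⟨ cong₂ _+_ (fromℤ-homo-* (+ d) (b ℤ.* b))
      (fromℤ-homo-* (k ℤ.* k) n) ⟨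
    fromℤ (+ d ℤ.* (b ℤ.* b)) + fromℤ
      (k ℤ.* k ℤ.* n)     ≡⟨ fromℤ-homo-+ (+ d ℤ.* (b ℤ.* b)) (k ℤ.* k ℤ.* n) ⟨
    fromℤ (+ d ℤ.* (b ℤ.* b) ℤ.+ k ℤ.* k ℤ.* n)           ∎)
  where
  open ≡-Reasoning
  k′ = fromℤ k
  d′ = fromℕ d

bounded-norm : ∀ D d p q → D * p * (D * p) - d * (D * q * (D * q)) ≡ D * D * (p * p - d * (q * q))
bounded-norm = solve 4 (λ D d p q → D :* p :* (D :* p) :- d :* (D :* q :* (D :* q)) := D :* D :* (p
  :* p :- d :* (q :* q))) refl

2ℚ 4ℚ : ℚ
2ℚ = fromℤ (+ 2)
4ℚ = fromℤ (+ 4)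

bounded-trace : ∀ D p → 2ℚ * (D * p) ≡ D * (2ℚ * p)
bounded-trace = solve 2 (λ D p → con 2ℚ :* (D :* p) := D :* (con 2ℚ :* p)) refl

trace-square : ∀ d p q → 2ℚ * (p * p + d * (q * q)) ≡ 2ℚ * p * (2ℚ * p) - 2ℚ * (p * p - d * (q * q))
trace-square = solve 3 (λ d p q → con 2ℚ :* (p :* p :+ d :* (q :* q)) := con 2ℚ :* p :* (con 2ℚ :*
  p) :- con 2ℚ :* (p :* p :- d :* (q :* q))) refl

square-minus-zero : ∀ x → x * x ≡ x * x - 0ℚ
square-minus-zero = solve 1 (λ x → x :* x := x :* x :- con 0ℚ) refl

discriminant : ∀ d p q → 2ℚ * p * (2ℚ * p) - 4ℚ * (p * p - d * (q * q)) ≡ d * (2ℚ * q * (2ℚ * q))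
discriminant = solve 3 (λ d p q → con 2ℚ :* p :* (con 2ℚ :* p) :- con 4ℚ :* (p :* p :- d :* (q :*
  q)) := d :* (con 2ℚ :* q :* (con 2ℚ :* q))) refl

module _ {d : ℕ} {x : ℚ[√ d ]} (D : ℤ) .{{_ : ℤ.NonZero D}} (powers : ∀ k → Bounded D (x ^ᴷ k)) where

  private
    y : ℕ → ℚ[√ d ]
    y = iterated-square x

  bounded-iterated-square : ∀ j → Bounded D (y j)
  bounded-iterated-square j with k , eq ← iterated-square-^ᴷ x j = subst (Bounded D) (sym eq) (powers k)

  -- The norms of the iterated squares of x are themselves iterated squares, and D² clears all of
  -- them.
  norm-integer₀ : Integer (norm x)
  norm-integer₀ = bounded-squares⇒integer (norm ∘ y) (λ _ → ℤ.0ℤ) (D ℤ.* D) {{ℤ.i*j≢0 D D}}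
    (λ j → trans (norm-homo-* (y j) (y j)) (square-minus-zero (norm (y j))))
    (λ j → let (p∈ , q∈) = bounded-iterated-square j in subst Integer
      (trans (bounded-norm (fromℤ D) (fromℕ d) (rat (y j)) (irr (y j)))
             (cong (_* norm (y j)) (sym (fromℤ-homo-* D D))))
      (integer-- (integer-* p∈ p∈) (integer-* (integer-fromℤ (+ d)) (integer-* q∈ q∈))))

  norm-integer : ∀ j → Integer (norm (y j))
  norm-integer zero    = norm-integer₀
  norm-integer (suc j) =
    subst Integer (sym (norm-homo-* (y j) (y j))) (integer-* (norm-integer j) (norm-integer j))

  -- The trace of y² is (trace y)² - 2 norm y. The correction term is an integer because the norms
  -- are already known to be integers.
  trace-integer : Integer (2ℚ * rat x)
  trace-integer = bounded-squares⇒integer (λ j → 2ℚ * rat (y j)) (λ j → + 2 ℤ.* value (norm-integer j))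
    D
    (λ j → trans (trace-square (fromℕ d) (rat (y j)) (irr (y j)))
      (cong (λ z → 2ℚ * rat (y j) * (2ℚ * rat (y j)) - z)
        (trans (cong (2ℚ *_) (equality (norm-integer j)))
          (sym (fromℤ-homo-* (+ 2) (value (norm-integer j)))))))
    (λ j → subst Integer (bounded-trace (fromℤ D) (rat (y j)))
      (integer-* (integer-fromℤ (+ 2)) (proj₁ (bounded-iterated-square j))))

squareFree⇒integer : ∀ {d r} → SquareFree d → Integer (fromℕ d * (r * r)) → Integer r
squareFree⇒integer {d} {r} sf int = ↧≡1⇒integer r (sf (↧ₙ r) (↧²∣ (+ d) r int))

coordinates : ∀ {d k} {x : ℚ[√ d ]} →
  Integer (fromℤ k * rat x) → Integer (fromℤ k * irr x) → Integer (norm x) → Coordinates k x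
coordinates (a , p) (b , q) (n , r) =
  record { a = a ; b = b ; n = n ; rat-eq = p ; irr-eq = q ; norm-eq = r }

-- For x = p + q√d, the integer (2p)² - 4 norm x equals d (2q)², and a square-free d cannot absorb
-- the square of a denominator of 2q.
integer-double-irr : ∀ {d} → SquareFree d → (x : ℚ[√ d ]) →
  Integer (2ℚ * rat x) → Integer (norm x) → Integer (2ℚ * irr x)
integer-double-irr {d} sf x T N = squareFree⇒integer {d} {2ℚ * irr x} sf
  (subst Integer (discriminant (fromℕ d) (rat x) (irr x))
    (integer-- (integer-* T T) (integer-* (integer-fromℤ (+ 4)) N)))

integral⇒coordinates : ∀ {d} → SquareFree d → {x : ℚ[√ d ]} → Integral x → Coordinates (+ 2) x
integral⇒coordinates {d} sf {x} x∈O = go (bounded-powers x∈O)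
  where
  go : (∃ λ D → ℤ.NonZero D × (∀ k → Bounded D (x ^ᴷ k))) → Coordinates (+ 2) x
  go (D , nz , powers) = coordinates {k = + 2} {x = x} T (integer-double-irr sf x T N) N
    where
    N : Integer (norm x)
    N = norm-integer₀ {x = x} D {{nz}} powers
    T : Integer (2ℚ * rat x)
    T = trace-integer {x = x} D {{nz}} powers

-- The test element for necessity and its trace form.

value-at : ∀ {d} → ℚ[√ d ] → ℚ[√ d ] → ℚ
value-at a x = Tr (a *ᴷ (x *ᴷ x))

Tr≡2rat : ∀ {d} (x : ℚ[√ d ]) → Tr x ≡ 2ℚ * rat x
Tr≡2rat {d} ⟨ p , q ⟩ = lemma (fromℕ d) p q
  where
  lemma : ∀ d p q → (p * 1ℚ + d * (q * 0ℚ)) + (p * 1ℚ + q * 0ℚ) ≡ 2ℚ * p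
  lemma = solve 3 (λ d p q → (p :* con 1ℚ :+ d :* (q :* con 0ℚ)) :+ (p :* con 1ℚ :+ q :* con 0ℚ) :=
    con 2ℚ :* p) refl

-- The interval from 0 to `u` serves both embeddings. At its upper end P - T u = (P² - d T²) / (2P),
-- which is positive; the other embedding has only positive terms.
totallyPositive : ∀ {d P T} → 0ℚ < fromℕ d → 0ℚ < P → 0ℚ < T → fromℕ d * (T * T) < P * P →
  TotallyPositive {d} ⟨ P , - T ⟩
totallyPositive {d} {P} {T} 0<d 0<P 0<T dT²<P² =
  (0ℚ , u , inj₂ 0²<d , (0<u , d<u²) , subst (0ℚ <_) (at-0 P (- T)) 0<P ,
    0<*⇒0< (<⇒≤ (0<+ 0<P (<⇒≤ 0<P))) (subst (0ℚ <_) gap (<⇒0<- dT²<P²))) ,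
  (0ℚ , u , inj₂ 0²<d , (0<u , d<u²) , subst (0ℚ <_) (at-0 P (- (- T))) 0<P ,
    subst (λ t → 0ℚ < P + t * u) (sym (neg-involutive T)) (0<+ 0<P (<⇒≤ (0<* 0<T 0<u))))
  where
  Y = (P + P) * T
  0<Y : 0ℚ < Y
  0<Y = 0<* (0<+ 0<P (<⇒≤ 0<P)) 0<T
  instance
    Y-nonZero = pos⇒nonZero Y {{positive 0<Y}}
  i = 1/ Y
  0<i : 0ℚ < i
  0<i = positive⁻¹ i {{1/pos⇒pos Y {{positive 0<Y}}}}
  -- The arithmetic mean of P / T and d T / P, whose geometric mean is √d.
  u = (P * P + fromℕ d * (T * T)) * i
  0<u : 0ℚ < u
  0<u = 0<* (0<+ (0<* 0<P 0<P) (0≤* (<⇒≤ 0<d) (0≤² T))) 0<i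
  0²<d : 0ℚ * 0ℚ < fromℕ d
  0²<d = 0<d
  at-0 : ∀ p q → p ≡ p + q * 0ℚ
  at-0 = solve 2 (λ p q → p := p :+ q :* con 0ℚ) refl
  mean-square : ∀ d P T i → (i * (P * P - d * (T * T))) * (i * (P * P - d * (T * T))) ≡
    (P * P + d * (T * T)) * i * ((P * P + d * (T * T)) * i) - d *
      (((P + P) * T * i) * ((P + P) * T * i))
  mean-square = solve 4 (λ d P T i → (i :* (P :* P :- d :* (T :* T))) :* (i :* (P :* P :- d :* (T :*
    T))) := (P :* P :+ d :* (T :* T)) :* i :* ((P :* P :+ d :* (T :* T)) :* i) :- d :* (((P :+ P) :*
    T :* i) :* ((P :+ P) :* T :* i))) refl
  one² : ∀ x → x * (1ℚ * 1ℚ) ≡ x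
  one² = solve 1 (λ x → x :* (con 1ℚ :* con 1ℚ) := x) refl
  d<u² : fromℕ d < u * u
  d<u² = 0<-⇒< (subst (0ℚ <_)
    (trans (mean-square (fromℕ d) P T i)
      (cong (λ z → u * u - z) (trans (cong (λ e → fromℕ d * (e * e)) (*-inverseʳ Y)) (one² (fromℕ d)))))
    (0<* (0<* 0<i (<⇒0<- dT²<P²)) (0<* 0<i (<⇒0<- dT²<P²))))
  gap-lemma : ∀ d P T i → (P + P) * P - (P + P) * T * i * (P * P + d * (T * T))
    ≡ (P + P) * (P + - T * ((P * P + d * (T * T)) * i))
  gap-lemma = solve 4 (λ d P T i → (P :+ P) :* P :- (P :+ P) :* T :* i :* (P :* P :+ d :* (T :* T))
    := (P :+ P) :* (P :+ :- T :* ((P :* P :+ d :* (T :* T)) :* i))) refl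
  gap-one : ∀ d P T → P * P - d * (T * T) ≡ (P + P) * P - 1ℚ * (P * P + d * (T * T))
  gap-one = solve 3 (λ d P T → P :* P :- d :* (T :* T) := (P :+ P) :* P :- con 1ℚ :* (P :* P :+ d :*
    (T :* T))) refl
  gap : P * P - fromℕ d * (T * T) ≡ (P + P) * (P + - T * u)
  gap = trans (gap-one (fromℕ d) P T)
    (trans (cong (λ e → (P + P) * P - e * (P * P + fromℕ d * (T * T))) (sym (*-inverseʳ Y)))
           (gap-lemma (fromℕ d) P T i))

unit-value : ∀ k d m c r s →
  k * k * (2ℚ * (4ℚ * m * d * (r * r + d * (s * s)) + d *
    (- (m * m + m * m + (d + d) - c) * (r * s + s * r))))
  ≡ 4ℚ * d * (2ℚ * m * (k * r * (k * r) + d * (k * s * (k * s))) - (m * m + m * m + (d + d) - c) *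
    (k * r * (k * s)))
unit-value = solve 6 (λ k d m c r s → k :* k :* (con 2ℚ :* (con 4ℚ :* m :* d :* (r :* r :+ d :* (s
  :* s)) :+ d :* (:- (m :* m :+ m :* m :+ (d :+ d) :- c) :* (r :* s :+ s :* r)))) := con 4ℚ :* d :*
  (con 2ℚ :* m :* (k :* r :* (k :* r) :+ d :* (k :* s :* (k :* s))) :- (m :* m :+ m :* m :+ (d :+ d)
  :- c) :* (k :* r :* (k :* s)))) refl

module _ {d : ℕ} (m k : ℕ) where

  private
    d′ = fromℕ d
    m′ = fromℕ m
    k′ = fromℕ k
    c = k′ * k′
    -- `T` makes `form m′ 1ℚ` equal to c m, half of `form k′ 0ℚ` = 2 c m, the scaled value at 1. `w`
    -- is 4m · m - T, that is, the square 4mM - TN of the completed form taken at (m, 1).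
    T w : ℚ
    T = m′ * m′ + m′ * m′ + (d′ + d′) - c
    w = 2ℚ * (m′ * m′ - d′) + c

  -- Up to the factor 4d/k², the value Tr (a x²) at x = (M + N√d)/k for the element a below.
  form : ℚ → ℚ → ℚ
  form M N = 2ℚ * m′ * (M * M + d′ * (N * N)) - T * (M * N)

  element : ℚ[√ d ]
  element = ⟨ 4ℚ * m′ * d′ , - T ⟩

  Tr-element : ∀ (x : ℚ[√ d ]) {M N} → k′ * rat x ≡ M → k′ * irr x ≡ N →
    k′ * k′ * value-at element x ≡ 4ℚ * d′ * form M N
  Tr-element x refl refl = trans (cong (k′ * k′ *_) (Tr≡2rat (element *ᴷ (x *ᴷ x))))
    (unit-value k′ d′ m′ c (rat x) (irr x))

  -- Completing the square, 8m · form = (4mM - TN)² + (16m²d - T²) N². At (m, 1) this reads 8cm² =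
  -- w² + 16m²d - T², so the bound on w gives 16m²d - T² ≥ 4cm². A point with value at most that of
  -- (m, 1) then has 4cm² N² ≤ 8cm².
  irr²≤2 : 0ℚ < m′ → 0ℚ < k′ → w * w ≤ 4ℚ * c * (m′ * m′) → ∀ {M N} → form M N ≤ form m′ 1ℚ →
    0ℚ ≤ 2ℚ - N * N
  irr²≤2 0<m 0<k w²≤ {M} {N} le = 0≤*⇒0≤ (0<* (0<* 0<4 (0<* 0<k 0<k)) (0<* 0<m 0<m))
    (subst (0ℚ ≤_) (lemma d′ m′ c M N)
      (0≤+ (0≤+ (0≤* (<⇒≤ (0<* 0<8 0<m)) (≤⇒0≤- le)) (0≤² (4ℚ * m′ * M - T * N)))
        (0≤* (≤⇒0≤- w²≤) (0≤² N))))
    where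
    0<4 : 0ℚ < 4ℚ
    0<4 = positive⁻¹ 4ℚ
    8ℚ = fromℕ 8
    0<8 : 0ℚ < 8ℚ
    0<8 = positive⁻¹ 8ℚ
    lemma : ∀ d m c M N →
      8ℚ * m * (2ℚ * m * (m * m + d * (1ℚ * 1ℚ)) - (m * m + m * m + (d + d) - c) *
        (m * 1ℚ) - (2ℚ * m * (M * M + d * (N * N)) - (m * m + m * m + (d + d) - c) * (M * N)))
      + (4ℚ * m * M - (m * m + m * m + (d + d) - c) * N) *
        (4ℚ * m * M - (m * m + m * m + (d + d) - c) * N)
      + (4ℚ * c * (m * m) - (2ℚ * (m * m - d) + c) * (2ℚ * (m * m - d) + c)) * (N * N)
      ≡ 4ℚ * c * (m * m) * (2ℚ - N * N)
    lemma = solve 5 (λ d m c M N → con 8ℚ :* m :* (con 2ℚ :* m :* (m :* m :+ d :* (con 1ℚ :* con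
      1ℚ)) :- (m :* m :+ m :* m :+ (d :+ d) :- c) :* (m :* con 1ℚ) :- (con 2ℚ :* m :* (M :* M :+ d
      :* (N :* N)) :- (m :* m :+ m :* m :+ (d :+ d) :- c) :* (M :* N))) :+ (con 4ℚ :* m :* M :- (m
      :* m :+ m :* m :+ (d :+ d) :- c) :* N) :* (con 4ℚ :* m :* M :- (m :* m :+ m :* m :+ (d :+ d)
      :- c) :* N) :+ (con 4ℚ :* c :* (m :* m) :- (con 2ℚ :* (m :* m :- d) :+ c) :* (con 2ℚ :* (m :*
      m :- d) :+ c)) :* (N :* N) := con 4ℚ :* c :* (m :* m) :* (con 2ℚ :- N :* N)) refl

  -- At N = 0 the comparison is 2mM² ≤ cm. The units ±1 correspond to M² = k² = c and violate it.
  rational-large : 0ℚ < m′ → ∀ {M} → form M 0ℚ ≤ form m′ 1ℚ → 0ℚ ≤ c - 2ℚ * (M * M)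
  rational-large 0<m {M} le = 0≤*⇒0≤ 0<m (subst (0ℚ ≤_) (lemma d′ m′ c M) (≤⇒0≤- le))
    where
    lemma : ∀ d m c M →
      2ℚ * m * (m * m + d * (1ℚ * 1ℚ)) - (m * m + m * m + (d + d) - c) * (m * 1ℚ)
      - (2ℚ * m * (M * M + d * (0ℚ * 0ℚ)) - (m * m + m * m + (d + d) - c) * (M * 0ℚ))
      ≡ m * (c - 2ℚ * (M * M))
    lemma = solve 4 (λ d m c M → con 2ℚ :* m :* (m :* m :+ d :* (con 1ℚ :* con 1ℚ)) :- (m :* m :+ m
      :* m :+ (d :+ d) :- c) :* (m :* con 1ℚ) :- (con 2ℚ :* m :* (M :* M :+ d :* (con 0ℚ :* con 0ℚ))
      :- (m :* m :+ m :* m :+ (d :+ d) :- c) :* (M :* con 0ℚ)) := m :* (c :- con 2ℚ :* (M :* M)))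
      refl

  -- The norm of the element is d (16m²d - T²), the same discriminant as in `irr²≤2`, hence d (8cm²
  -- - w²).
  element-totallyPositive : 0ℚ < d′ → 0ℚ < m′ → 0ℚ < k′ → 0ℚ < T → w * w ≤ 4ℚ * c * (m′ * m′) →
    TotallyPositive element
  element-totallyPositive 0<d 0<m 0<k 0<T w²≤ =
    totallyPositive {d} 0<d (0<* (0<* 0<4 0<m) 0<d) 0<T (0<-⇒< (subst (0ℚ <_) (lemma d′ m′ c)
      (0<* 0<d (0<+ (0<* (0<* 0<4 (0<* 0<k 0<k)) (0<* 0<m 0<m)) (≤⇒0≤- w²≤)))))
    where
    0<4 : 0ℚ < 4ℚ
    0<4 = positive⁻¹ 4ℚ
    lemma : ∀ d m c →
      d * (4ℚ * c * (m * m) + (4ℚ * c * (m * m) - (2ℚ * (m * m - d) + c) * (2ℚ * (m * m - d) + c)))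
      ≡ 4ℚ * m * d * (4ℚ * m * d) - d * ((m * m + m * m + (d + d) - c) * (m * m + m * m + (d + d) - c))
    lemma = solve 3 (λ d m c → d :* (con 4ℚ :* c :* (m :* m) :+ (con 4ℚ :* c :* (m :* m) :- (con 2ℚ
      :* (m :* m :- d) :+ c) :* (con 2ℚ :* (m :* m :- d) :+ c))) := con 4ℚ :* m :* d :* (con 4ℚ :* m
      :* d) :- d :* ((m :* m :+ m :* m :+ (d :+ d) :- c) :* (m :* m :+ m :* m :+ (d :+ d) :- c)))
      refl

-- From unit reducibility to the norm equation.

PlusMinusOne : ℤ → Set
PlusMinusOne n = n ≡ ℤ.1ℤ ⊎ n ≡ ℤ.-1ℤ

∣n∣≡1⇒±1 : ∀ n → ℤ.∣ n ∣ ≡ 1 → PlusMinusOne n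
∣n∣≡1⇒±1 (+ n)         refl = inj₁ refl
∣n∣≡1⇒±1 ℤ.-[1+ zero ] refl = inj₂ refl

*≡1⇒±1 : ∀ i j → i ℤ.* j ≡ ℤ.1ℤ → PlusMinusOne i
*≡1⇒±1 i j eq = ∣n∣≡1⇒±1 i (ℕ.m*n≡1⇒m≡1 ℤ.∣ i ∣ ℤ.∣ j ∣ (trans (sym (ℤ.abs-* i j)) (cong ℤ.∣_∣ eq)))

unit-norm : ∀ {d k} → (∀ (x : ℚ[√ d ]) → Integral x → Coordinates k x) →
  (u : ℚ[√ d ]) → IntegralUnit u → ∃ λ (c : Coordinates k u) → PlusMinusOne (n c)
unit-norm {d} coord u (u∈O , v , v∈O , uv≡1) = cu , *≡1⇒±1 (n cu) (n cv) (fromℤ-injective (begin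
  fromℤ (n cu ℤ.* n cv)     ≡⟨ fromℤ-homo-* (n cu) (n cv) ⟩
  fromℤ (n cu) * fromℤ (n cv) ≡⟨ cong₂ _*_ (norm-eq cu) (norm-eq cv) ⟨
  norm u * norm v           ≡⟨ norm-homo-* u v ⟨
  norm (u *ᴷ v)             ≡⟨ cong norm uv≡1 ⟩
  norm {d} 1ᴷ               ≡⟨ lemma (fromℕ d) ⟩
  1ℚ                        ∎))
  where
  open ≡-Reasoning
  cu = coord u u∈O
  cv = coord v v∈O
  lemma : ∀ d → 1ℚ * 1ℚ - d * (0ℚ * 0ℚ) ≡ 1ℚ
  lemma = solve 1 (λ d → con 1ℚ :* con 1ℚ :- d :* (con 0ℚ :* con 0ℚ) := con 1ℚ) refl

*-self≤2 : ∀ i → i ℤ.* i ℤ.≤ + 2 → i ≡ ℤ.0ℤ ⊎ i ℤ.* i ≡ ℤ.1ℤ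
*-self≤2 (+ zero)                _ = inj₁ refl
*-self≤2 (+ suc zero)            _ = inj₂ refl
*-self≤2 (+ suc (suc i)) (ℤ.+≤+ (s≤s (s≤s p))) =
  contradiction (subst (ℕ._≤ 0) (ℕ.+-suc i _) p) λ ()
*-self≤2 ℤ.-[1+ zero ]           _ = inj₂ refl
*-self≤2 ℤ.-[1+ suc i ] (ℤ.+≤+ (s≤s (s≤s p))) =
  contradiction (subst (ℕ._≤ 0) (ℕ.+-suc i _) p) λ ()

fromℕ-pos : ∀ n .{{_ : ℕ.NonZero n}} → 0ℚ < fromℕ n
fromℕ-pos (suc n) = fromℤ-mono-< {ℤ.0ℤ} {+ suc n} (ℤ.+<+ (s≤s z≤n))

module _ {d m k : ℕ} .{{_ : ℕ.NonZero d}} .{{_ : ℕ.NonZero m}} .{{_ : ℕ.NonZero k}}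
  (x₀ : ℚ[√ d ]) (x₀-rat : fromℕ k * rat x₀ ≡ fromℕ m) (x₀-irr : fromℕ k * irr x₀ ≡ 1ℚ) where

  private
    m′ = fromℕ m
    d′ = fromℕ d
    k² = fromℕ k * fromℕ k
    w = 2ℚ * (m′ * m′ - d′) + k²
    α : ℚ[√ d ]
    α = element m k
    0<d = fromℕ-pos d
    0<k = fromℕ-pos k
    0<m = fromℕ-pos m

  -- The irrational coordinate N satisfies N² ≤ 2. If N² = 1, the norm of u is the desired equation.
  -- If N = 0, then M² = ±k²: the sign + contradicts `rational-large`, the sign - contradicts M² ≥
  -- 0.
  norm-equation : w * w ≤ 4ℚ * k² * (m′ * m′) → ∀ u (c : Coordinates (+ k) u) → PlusMinusOne (n c) →
    value-at α u ≤ value-at α x₀ → ∃₂ λ M n → PlusMinusOne n × M ℤ.* M ≡ + d ℤ.+ + k ℤ.* + k ℤ.* n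
  norm-equation w²≤ u c ±1 u≤x₀ = conclude (*-self≤2 (b c) b²≤2)
    where
    form≤ : form {d} m k (fromℤ (a c)) (fromℤ (b c)) ≤ form {d} m k (fromℕ m) 1ℚ
    form≤ = *-cancelˡ-≤-pos (4ℚ * fromℕ d) {{positive (0<* {4ℚ} (positive⁻¹ 4ℚ) 0<d)}}
      (subst₂ _≤_ (Tr-element m k u (rat-eq c) (irr-eq c)) (Tr-element m k x₀ x₀-rat x₀-irr)
        (*-monoˡ-≤-nonNeg k² {{nonNegative (<⇒≤ (0<* 0<k 0<k))}} u≤x₀))

    b²≤2 : b c ℤ.* b c ℤ.≤ + 2
    b²≤2 = fromℤ-cancel-≤ (subst (_≤ 2ℚ) (sym (fromℤ-homo-* (b c) (b c)))
      (0≤-⇒≤ (irr²≤2 {d} m k 0<m 0<k w²≤ {fromℤ (a c)} {fromℤ (b c)} form≤)))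

    conclude : b c ≡ ℤ.0ℤ ⊎ b c ℤ.* b c ≡ ℤ.1ℤ → ∃₂ λ M n → PlusMinusOne n × M ℤ.* M
      ≡ + d ℤ.+ + k ℤ.* + k ℤ.* n
    conclude (inj₂ b²≡1) = a c , n c , ±1 , (begin
      a c ℤ.* a c                                      ≡⟨ coordinates-norm c ⟩
      + d ℤ.* (b c ℤ.* b c) ℤ.+ + k ℤ.* + k ℤ.* n
        c    ≡⟨ cong (λ z → + d ℤ.* z ℤ.+ + k ℤ.* + k ℤ.* n c) b²≡1 ⟩
      + d ℤ.* ℤ.1ℤ ℤ.+ + k ℤ.* + k ℤ.* n
        c             ≡⟨ cong (ℤ._+ + k ℤ.* + k ℤ.* n c) (ℤ.*-identityʳ (+ d)) ⟩
      + d ℤ.+ + k ℤ.* + k ℤ.* n c                      ∎)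
      where open ≡-Reasoning
    conclude (inj₁ b≡0) = ⊥-elim (absurd ±1)
      where
      a²≡k²n : a c ℤ.* a c ≡ + k ℤ.* + k ℤ.* n c
      a²≡k²n = trans (coordinates-norm c)
        (trans (cong (λ z → + d ℤ.* (z ℤ.* z) ℤ.+ + k ℤ.* + k ℤ.* n c) b≡0)
        (lemma (+ d) (+ k ℤ.* + k ℤ.* n c)))
        where
        lemma : ∀ d x → d ℤ.* (ℤ.0ℤ ℤ.* ℤ.0ℤ) ℤ.+ x ≡ x
        lemma = solve-∀
      a²-rational : fromℤ (a c) * fromℤ (a c) ≡ k² * fromℤ (n c)
      a²-rational = trans (sym (fromℤ-homo-* (a c) (a c))) (trans (cong fromℤ a²≡k²n)
        (trans (fromℤ-homo-* (+ k ℤ.* + k) (n c)) (cong (_* fromℤ (n c)) (fromℤ-homo-* (+ k) (+ k)))))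
      small : 0ℚ ≤ k² - 2ℚ * (k² * fromℤ (n c))
      small = subst (λ z → 0ℚ ≤ k² - 2ℚ * z) a²-rational
        (rational-large {d} m k 0<m {fromℤ (a c)}
          (subst (λ z → form {d} m k (fromℤ (a c)) z ≤ form {d} m k (fromℕ m) 1ℚ)
          (cong fromℤ b≡0) form≤))
      minus : ∀ x → x - 2ℚ * (x * 1ℚ) ≡ - x
      minus = solve 1 (λ x → x :- con 2ℚ :* (x :* con 1ℚ) := :- x) refl
      neg : ∀ x → x * - 1ℚ ≡ - x
      neg = solve 1 (λ x → x :* :- con 1ℚ := :- x) refl
      -k²<0 : ¬ (0ℚ ≤ - k²)
      -k²<0 le = <-irrefl refl (<-≤-trans (0<* 0<k 0<k)
        (subst (_≤ 0ℚ) (neg-involutive k²) (neg-antimono-≤ le)))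
      absurd : PlusMinusOne (n c) → ⊥
      absurd (inj₁ n≡1)  = -k²<0 (subst (0ℚ ≤_) (minus k²)
        (subst (λ z → 0ℚ ≤ k² - 2ℚ * (k² * fromℤ z)) n≡1 small))
      absurd (inj₂ n≡-1) = -k²<0 (subst (0ℚ ≤_)
        (trans a²-rational (trans (cong (λ z → k² * fromℤ z) n≡-1) (neg k²)))
        (0≤² (fromℤ (a c))))

  -- The minimum over nonzero integers is at most the value at x₀, and by hypothesis it is attained
  -- at a unit, to which `norm-equation` applies.
  reducible⇒norm-equation : Integral x₀ → (∀ (x : ℚ[√ d ]) → Integral x → Coordinates (+ k) x) →
    0ℚ < m′ * m′ + m′ * m′ + (d′ + d′) - k² → w * w ≤ 4ℚ * k² * (m′ * m′) →
    UnitReducible d → ∃₂ λ M n → PlusMinusOne n × M ℤ.* M ≡ + d ℤ.+ + k ℤ.* + k ℤ.* n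
  reducible⇒norm-equation x₀∈O coord 0<T w²≤ reducible =
    go (reducible (element m k) (element-totallyPositive {d} m k 0<d 0<m 0<k 0<T w²≤))
    where
    x₀≢0 : x₀ ≢ 0ᴷ
    x₀≢0 x₀≡0 = 1≢0 (trans (sym x₀-irr) (trans (cong (λ x → fromℕ k * irr x) x₀≡0) (*-zeroʳ (fromℕ k))))

    go : (∃ λ μ → IsMinimumOver NonZeroInteger (value-at α) μ
          × IsMinimumOver IntegralUnit (value-at α) μ) →
      ∃₂ λ M n → PlusMinusOne n × M ℤ.* M ≡ + d ℤ.+ + k ℤ.* + k ℤ.* n
    go (μ , (_ , minimal) , ((u , u-unit , value≡μ) , _)) =
      norm-equation w²≤ u (proj₁ c) (proj₂ c)
        (subst (_≤ value-at α x₀) (sym value≡μ) (minimal x₀ (x₀∈O , x₀≢0)))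
      where
      c = unit-norm coord u u-unit

-- Nonnegativity of the trace form of a totally positive element.

-- p² - d q² = (p - qu)(p + qu) + q² (u² - d), with every factor nonnegative.
cut-positive : ∀ d p q u → 0ℚ ≤ q → 0ℚ < u → d < u * u → 0ℚ < p + - q * u →
  0ℚ < p × 0ℚ ≤ p * p - d * (q * q)
cut-positive d p q u 0≤q 0<u d<u² 0<p-qu =
  0<p , subst (0ℚ ≤_) (lemma d p q u)
    (0≤+ (0≤* (<⇒≤ 0<p-qu) (0≤+ (<⇒≤ 0<p) 0≤qu)) (0≤* (0≤² q) (<⇒≤ (<⇒0<- d<u²))))
  where
  0≤qu : 0ℚ ≤ q * u
  0≤qu = 0≤* 0≤q (<⇒≤ 0<u)
  sum : ∀ p q u → (p + - q * u) + q * u ≡ p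
  sum = solve 3 (λ p q u → (p :+ :- q :* u) :+ q :* u := p) refl
  0<p : 0ℚ < p
  0<p = subst (0ℚ <_) (sum p q u) (0<+ 0<p-qu 0≤qu)
  lemma : ∀ d p q u → (p + - q * u) * (p + q * u) + q * q * (u * u - d) ≡ p * p - d * (q * q)
  lemma = solve 4 (λ d p q u → (p :+ :- q :* u) :* (p :+ q :* u) :+ q :* q :* (u :* u :- d) := p :*
    p :- d :* (q :* q)) refl

neg-irr : ∀ d p q → p * p - d * (- q * - q) ≡ p * p - d * (q * q)
neg-irr = solve 3 (λ d p q → p :* p :- d :* (:- q :* :- q) := p :* p :- d :* (q :* q)) refl

-- Whatever the sign of q, one of the two embeddings is p - |q| √d; the upper end of its interval is
-- the one to use.
totallyPositive⇒norm : ∀ {d} (a : ℚ[√ d ]) → TotallyPositive a → 0ℚ < rat a × 0ℚ ≤ norm a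
totallyPositive⇒norm {d} ⟨ p , q ⟩ ((_ , u , _ , (0<u , d<u²) , _ , p+qu) ,
  (_ , v , _ , (0<v , d<v²) , _ , p-qv)) =
  [ (λ 0≤q → cut-positive (fromℕ d) p q v 0≤q 0<v d<v² p-qv)
  , (λ q≤0 → Product.map₂ (subst (0ℚ ≤_) (neg-irr (fromℕ d) p q))
      (cut-positive (fromℕ d) p (- q) u (neg-antimono-≤ q≤0) 0<u d<u²
        (subst (λ z → 0ℚ < p + z * u) (sym (neg-involutive q)) p+qu)))
  ]′ (≤-total 0ℚ q)

-- With a = p + q√d and x = r + s√d, p times the rational part of a x² is the square (pr + dqs)²
-- plus d · norm a · s².
Tr-square-nonNeg : ∀ {d} (a : ℚ[√ d ]) → TotallyPositive a → ∀ x → 0ℚ ≤ value-at a x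
Tr-square-nonNeg {d} a@(⟨ p , q ⟩) tp x@(⟨ r , s ⟩) = subst (0ℚ ≤_) (sym (Tr≡2rat (a *ᴷ (x *ᴷ x))))
  (0≤* (nonNegative⁻¹ 2ℚ) (0≤*⇒0≤ 0<p (subst (0ℚ ≤_) (lemma (fromℕ d) p q r s)
    (0≤+ (0≤² (p * r + fromℕ d * (q * s)))
      (0≤* (0≤* (fromℤ-mono-≤ {ℤ.0ℤ} {+ d} (ℤ.+≤+ z≤n)) 0≤n) (0≤² s))))))
  where
  0<p = proj₁ (totallyPositive⇒norm a tp)
  0≤n = proj₂ (totallyPositive⇒norm a tp)
  lemma : ∀ d p q r s → (p * r + d * (q * s)) * (p * r + d * (q * s)) + d * (p * p - d * (q * q)) *
    (s * s)
    ≡ p * (p * (r * r + d * (s * s)) + d * (q * (r * s + s * r)))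
  lemma = solve 5 (λ d p q r s → (p :* r :+ d :* (q :* s)) :* (p :* r :+ d :* (q :* s)) :+ d :* (p
    :* p :- d :* (q :* q)) :* (s :* s) := p :* (p :* (r :* r :+ d :* (s :* s)) :+ d :* (q :* (r :* s
    :+ s :* r)))) refl

-- Minima of binary quadratic forms over nonzero integer pairs.

0<i² : ∀ {i} → i ≢ ℤ.0ℤ → ℤ.0ℤ ℤ.< i ℤ.* i
0<i² {+ zero}      i≢0 = contradiction refl i≢0
0<i² {+ suc n}     _   = ℤ.+<+ (s≤s z≤n)
0<i² {ℤ.-[1+ n ]}  _   = ℤ.+<+ (s≤s z≤n)

0≤i² : ∀ i → ℤ.0ℤ ℤ.≤ i ℤ.* i
0≤i² i with i ℤ.≟ ℤ.0ℤ
... | yes refl = ℤ.≤-refl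
... | no i≢0   = ℤ.<⇒≤ (0<i² i≢0)

0<⇒1≤ : ∀ {i} → ℤ.0ℤ ℤ.< i → 1ℚ ≤ fromℤ i
0<⇒1≤ {i} 0<i = fromℤ-mono-≤ {ℤ.1ℤ} {i} (ℤ.i<j⇒suc[i]≤j 0<i)

NonZeroPair : ℤ → ℤ → Set
NonZeroPair i j = ¬ (i ≡ ℤ.0ℤ × j ≡ ℤ.0ℤ)

1≤i²+j² : ∀ i j → NonZeroPair i j → 1ℚ ≤ fromℤ i * fromℤ i + fromℤ j * fromℤ j
1≤i²+j² i j nz = subst (1ℚ ≤_)
  (trans (fromℤ-homo-+ (i ℤ.* i) (j ℤ.* j)) (cong₂ _+_ (fromℤ-homo-* i i) (fromℤ-homo-* j j)))
  (0<⇒1≤ positive-sum)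
  where
  positive-sum : ℤ.0ℤ ℤ.< i ℤ.* i ℤ.+ j ℤ.* j
  positive-sum with i ℤ.≟ ℤ.0ℤ | j ℤ.≟ ℤ.0ℤ
  ... | no i≢0 | _      = ℤ.+-mono-<-≤ (0<i² i≢0) (0≤i² j)
  ... | yes _  | no j≢0 = ℤ.+-mono-≤-< (0≤i² i) (0<i² j≢0)
  ... | yes p  | yes q  = contradiction (p , q) nz

-- Four times the form is (2i + j)² + 3j², so the form is a positive integer.
1≤i²+ij+j² : ∀ i j → NonZeroPair i j → 1ℚ ≤ fromℤ i * fromℤ i + fromℤ i * fromℤ j + fromℤ j * fromℤ j
1≤i²+ij+j² i j nz = subst (1ℚ ≤_)
  (trans (fromℤ-homo-+ (i ℤ.* i ℤ.+ i ℤ.* j) (j ℤ.* j)) (cong₂ _+_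
    (trans (fromℤ-homo-+ (i ℤ.* i) (i ℤ.* j)) (cong₂ _+_ (fromℤ-homo-* i i) (fromℤ-homo-* i j)))
      (fromℤ-homo-* j j)))
  (0<⇒1≤ (ℤ.*-cancelˡ-<-nonNeg (+ 4) (subst (ℤ.0ℤ ℤ.<_) (lemma i j) positive-form)))
  where
  lemma : ∀ i j → (i ℤ.+ i ℤ.+ j) ℤ.* (i ℤ.+ i ℤ.+ j) ℤ.+ + 3 ℤ.* (j ℤ.* j)
    ≡ + 4 ℤ.* (i ℤ.* i ℤ.+ i ℤ.* j ℤ.+ j ℤ.* j)
  lemma = solve-∀
  even : ∀ i → + 4 ℤ.* (i ℤ.* i) ≡ (i ℤ.+ i ℤ.+ ℤ.0ℤ) ℤ.* (i ℤ.+ i ℤ.+ ℤ.0ℤ) ℤ.+ + 3 ℤ.* (ℤ.0ℤ ℤ.* ℤ.0ℤ)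
  even = solve-∀
  positive-form : ℤ.0ℤ ℤ.< (i ℤ.+ i ℤ.+ j) ℤ.* (i ℤ.+ i ℤ.+ j) ℤ.+ + 3 ℤ.* (j ℤ.* j)
  positive-form with j ℤ.≟ ℤ.0ℤ
  ... | no j≢0   = ℤ.+-mono-≤-< (0≤i² (i ℤ.+ i ℤ.+ j)) (ℤ.*-monoˡ-<-pos (+ 3) (0<i² j≢0))
  ... | yes refl = subst (ℤ.0ℤ ℤ.<_) (even i) (ℤ.*-monoˡ-<-pos (+ 4) (0<i² λ i≡0 → nz (i≡0 , refl)))

-- This is Tr (w (K + Nε)²) for α = Tr w and β = Tr (wε): since ε² = tε - n, the last coefficient Tr
-- (wε²) is tβ - nα. The pairs (0, 1) and (t, -1) stand for ε and its conjugate.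
quadratic : (α β t n K N : ℚ) → ℚ
quadratic α β t n K N = K * K * α + 2ℚ * (K * N * β) + N * N * (t * β - n * α)

module _ (α β : ℚ) (t i j : ℤ) (nz : NonZeroPair i j) where

  private
    t′ = fromℤ t
    K = fromℤ i
    N = fromℤ j
    i+tj = i ℤ.+ t ℤ.* j

    shifted : fromℤ i+tj ≡ K + t′ * N
    shifted = trans (fromℤ-homo-+ i (t ℤ.* j)) (cong (λ z → K + z) (fromℤ-homo-* t j))

    nz-shifted : NonZeroPair i+tj j
    nz-shifted (p , refl) = nz (trans (sym (lemma i t)) p , refl)
      where
      lemma : ∀ i t → i ℤ.+ t ℤ.* ℤ.0ℤ ≡ i
      lemma = solve-∀

    nz-shifted-neg : NonZeroPair i+tj (ℤ.- j)
    nz-shifted-neg (p , q) = nz-shifted (p , trans (sym (ℤ.neg-involutive j)) (cong ℤ.-_ q))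

  -- The form is linear in β, and for norm −1 it is a sum of two squares at both ends of 0 ≤ β ≤ tα.
  reduced-norm-1 : 0ℚ < t′ → α ≤ quadratic α β t′ (- 1ℚ) 0ℚ 1ℚ → α ≤ quadratic α β t′ (- 1ℚ) t′ (- 1ℚ) →
    α ≤ quadratic α β t′ (- 1ℚ) K N
  -- K + tN and -N are the coordinates of the conjugate of K + Nε; they turn the end β = tα into the
  -- end β = 0.
  reduced-norm-1 0<t h₁ h₂ = 0≤-⇒≤ (0≤*⇒0≤ 0<t (subst (0ℚ ≤_) (lemma t′ α β K N)
      (0≤+ (0≤* 0≤tα-β (≤⇒0≤- (1≤i²+j² i j nz)))
           (0≤* 0≤β (≤⇒0≤- (subst (λ z → 1ℚ ≤ z * z + N * N) shifted (1≤i²+j² i+tj j nz-shifted)))))))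
    where
    lemma₁ : ∀ t α β → (0ℚ * 0ℚ * α + 2ℚ * (0ℚ * 1ℚ * β) + 1ℚ * 1ℚ * (t * β - (- 1ℚ) * α)) - α ≡ t * β
    lemma₁ = solve 3 (λ t α β → (con 0ℚ :* con 0ℚ :* α :+ con 2ℚ :* (con 0ℚ :* con 1ℚ :* β) :+ con
      1ℚ :* con 1ℚ :* (t :* β :- (:- con 1ℚ) :* α)) :- α := t :* β) refl
    lemma₂ : ∀ t α β → (t * t * α + 2ℚ * (t * (- 1ℚ) * β) + (- 1ℚ) * (- 1ℚ) * (t * β - (- 1ℚ) * α)) - α
      ≡ t * (t * α - β)
    lemma₂ = solve 3 (λ t α β → (t :* t :* α :+ con 2ℚ :* (t :* (:- con 1ℚ) :* β) :+ (:- con 1ℚ) :*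
      (:- con 1ℚ) :* (t :* β :- (:- con 1ℚ) :* α)) :- α := t :* (t :* α :- β)) refl
    0≤β : 0ℚ ≤ β
    0≤β = 0≤*⇒0≤ 0<t (subst (0ℚ ≤_) (lemma₁ t′ α β) (≤⇒0≤- h₁))
    0≤tα-β : 0ℚ ≤ t′ * α - β
    0≤tα-β = 0≤*⇒0≤ 0<t (subst (0ℚ ≤_) (lemma₂ t′ α β) (≤⇒0≤- h₂))
    lemma : ∀ t α β K N →
      (t * α - β) * (K * K + N * N - 1ℚ) + β * ((K + t * N) * (K + t * N) + N * N - 1ℚ)
      ≡ t * ((K * K * α + 2ℚ * (K * N * β) + N * N * (t * β - (- 1ℚ) * α)) - α)
    lemma = solve 5 (λ t α β K N → (t :* α :- β) :* (K :* K :+ N :* N :- con 1ℚ) :+ β :* ((K :+ t :*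
      N) :* (K :+ t :* N) :+ N :* N :- con 1ℚ) := t :* ((K :* K :* α :+ con 2ℚ :* (K :* N :* β) :+ N
      :* N :* (t :* β :- (:- con 1ℚ) :* α)) :- α)) refl

  -- For norm 1 both ends of the interval 2α ≤ tβ ≤ (t² − 2)α give a form equivalent to tK² + 4KN + tN².
  reduced-norm+1 : 4ℚ ≤ t′ → α ≤ quadratic α β t′ 1ℚ 0ℚ 1ℚ → α ≤ quadratic α β t′ 1ℚ t′ (- 1ℚ) →
    α ≤ quadratic α β t′ 1ℚ K N
  -- The two ends are again exchanged by conjugation, (K, N) ↦ (K + tN, -N); here the sign of N
  -- matters because of the mixed term.
  reduced-norm+1 4≤t h₁ h₂ = 0≤-⇒≤ (0≤*⇒0≤ (0<* 0<t 0<t²-4) (subst (0ℚ ≤_) (lemma t′ α β K N)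
      (0≤+ (0≤* 0≤λ₂ (ends i j nz))
           (0≤* 0≤λ₁ (subst₂ (λ y z → 0ℚ ≤ end y z) shifted (fromℤ-homo-neg j)
             (ends i+tj (ℤ.- j) nz-shifted-neg))))))
    where
    0<t : 0ℚ < t′
    0<t = <-≤-trans (positive⁻¹ 4ℚ) 4≤t
    0<t²-4 : 0ℚ < t′ * t′ - 4ℚ
    0<t²-4 = subst (0ℚ <_) (lemma-t t′)
      (0<+ (positive⁻¹ 12ℚ) (0≤* (≤⇒0≤- 4≤t) (0≤+ (<⇒≤ 0<t) (nonNegative⁻¹ 4ℚ))))
      where
      12ℚ = fromℕ 12
      lemma-t : ∀ t → 12ℚ + (t - 4ℚ) * (t + 4ℚ) ≡ t * t - 4ℚ
      lemma-t = solve 1 (λ t → con 12ℚ :+ (t :- con 4ℚ) :* (t :+ con 4ℚ) := t :* t :- con 4ℚ) refl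
    -- This is tK² + 4KN + tN² minus its value t at (1, 0), split into two forms that are each at
    -- least 1 on nonzero pairs; the weight t - 4 is nonnegative by hypothesis.
    end : ℚ → ℚ → ℚ
    end K N = (t′ - 4ℚ) * (K * K + N * N - 1ℚ) + 4ℚ * (K * K + K * N + N * N - 1ℚ)
    ends : ∀ i j → NonZeroPair i j → 0ℚ ≤ end (fromℤ i) (fromℤ j)
    ends i j nz = 0≤+ (0≤* (≤⇒0≤- 4≤t) (≤⇒0≤- (1≤i²+j² i j nz)))
                      (0≤* (nonNegative⁻¹ 4ℚ) (≤⇒0≤- (1≤i²+ij+j² i j nz)))
    lemma₁ : ∀ t α β → (0ℚ * 0ℚ * α + 2ℚ * (0ℚ * 1ℚ * β) + 1ℚ * 1ℚ * (t * β - 1ℚ * α)) - α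
      ≡ t * β - 2ℚ * α
    lemma₁ = solve 3 (λ t α β → (con 0ℚ :* con 0ℚ :* α :+ con 2ℚ :* (con 0ℚ :* con 1ℚ :* β) :+ con
      1ℚ :* con 1ℚ :* (t :* β :- con 1ℚ :* α)) :- α := t :* β :- con 2ℚ :* α) refl
    lemma₂ : ∀ t α β → (t * t * α + 2ℚ * (t * (- 1ℚ) * β) + (- 1ℚ) * (- 1ℚ) * (t * β - 1ℚ * α)) - α
      ≡ (t * t - 2ℚ) * α - t * β
    lemma₂ = solve 3 (λ t α β → (t :* t :* α :+ con 2ℚ :* (t :* (:- con 1ℚ) :* β) :+ (:- con 1ℚ) :*
      (:- con 1ℚ) :* (t :* β :- con 1ℚ :* α)) :- α := (t :* t :- con 2ℚ) :* α :- t :* β) refl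
    0≤λ₁ : 0ℚ ≤ t′ * β - 2ℚ * α
    0≤λ₁ = subst (0ℚ ≤_) (lemma₁ t′ α β) (≤⇒0≤- h₁)
    0≤λ₂ : 0ℚ ≤ (t′ * t′ - 2ℚ) * α - t′ * β
    0≤λ₂ = subst (0ℚ ≤_) (lemma₂ t′ α β) (≤⇒0≤- h₂)
    lemma : ∀ t α β K N →
      ((t * t - 2ℚ) * α - t * β) * ((t - 4ℚ) * (K * K + N * N - 1ℚ) + 4ℚ * (K * K + K * N + N * N - 1ℚ))
      + (t * β - 2ℚ * α) * ((t - 4ℚ) * ((K + t * N) * (K + t * N) + (- N) * (- N) - 1ℚ)
                            + 4ℚ * ((K + t * N) * (K + t * N) + (K + t * N) * (- N) + (- N) *
                              (- N) - 1ℚ))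
      ≡ t * (t * t - 4ℚ) * ((K * K * α + 2ℚ * (K * N * β) + N * N * (t * β - 1ℚ * α)) - α)
    lemma = solve 5 (λ t α β K N → ((t :* t :- con 2ℚ) :* α :- t :* β) :* ((t :- con 4ℚ) :* (K :* K
      :+ N :* N :- con 1ℚ) :+ con 4ℚ :* (K :* K :+ K :* N :+ N :* N :- con 1ℚ)) :+ (t :* β :- con 2ℚ
      :* α) :* ((t :- con 4ℚ) :* ((K :+ t :* N) :* (K :+ t :* N) :+ (:- N) :* (:- N) :- con 1ℚ) :+
      con 4ℚ :* ((K :+ t :* N) :* (K :+ t :* N) :+ (K :+ t :* N) :* (:- N) :+ (:- N) :* (:- N) :-
      con 1ℚ)) := t :* (t :* t :- con 4ℚ) :* ((K :* K :* α :+ con 2ℚ :* (K :* N :* β) :+ N :* N :*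
      (t :* β :- con 1ℚ :* α)) :- α)) refl

-- The ring ℤ[ε]: units, descent and minimality.

interchange-rat : ∀ d a b p q r s t u →
  (a * p + d * (b * q)) * (r * t + d * (s * u)) + d * ((a * q + b * p) * (r * u + s * t))
  ≡ (a * r + d * (b * s)) * (p * t + d * (q * u)) + d * ((a * s + b * r) * (p * u + q * t))
interchange-rat = solve 9 (λ d a b p q r s t u → (a :* p :+ d :* (b :* q)) :* (r :* t :+ d :* (s :*
  u)) :+ d :* ((a :* q :+ b :* p) :* (r :* u :+ s :* t)) := (a :* r :+ d :* (b :* s)) :* (p :* t :+
  d :* (q :* u)) :+ d :* ((a :* s :+ b :* r) :* (p :* u :+ q :* t))) refl

interchange-irr : ∀ d a b p q r s t u →
  (a * p + d * (b * q)) * (r * u + s * t) + (a * q + b * p) * (r * t + d * (s * u))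
  ≡ (a * r + d * (b * s)) * (p * u + q * t) + (a * s + b * r) * (p * t + d * (q * u))
interchange-irr = solve 9 (λ d a b p q r s t u → (a :* p :+ d :* (b :* q)) :* (r :* u :+ s :* t) :+
  (a :* q :+ b :* p) :* (r :* t :+ d :* (s :* u)) := (a :* r :+ d :* (b :* s)) :* (p :* u :+ q :* t)
  :+ (a :* s :+ b :* r) :* (p :* t :+ d :* (q :* u))) refl

*ᴷ-interchange : ∀ {d} (w x y z : ℚ[√ d ]) → (w *ᴷ x) *ᴷ (y *ᴷ z) ≡ (w *ᴷ y) *ᴷ (x *ᴷ z)
*ᴷ-interchange {d} ⟨ a , b ⟩ ⟨ p , q ⟩ ⟨ r , s ⟩ ⟨ t , u ⟩ =
  cong₂ ⟨_,_⟩ (interchange-rat (fromℕ d) a b p q r s t u) (interchange-irr (fromℕ d) a b p q r s t u)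

-- Because of this identity, the reduction can keep a fixed and move only the unit u.
value-at-*ᴷ : ∀ {d} (a u z : ℚ[√ d ]) → value-at a (u *ᴷ z) ≡ value-at (a *ᴷ (u *ᴷ u)) z
value-at-*ᴷ a u z = cong Tr (trans (cong (a *ᴷ_) (*ᴷ-interchange u z u z))
  (sym (*ᴷ-assoc a (u *ᴷ u) (z *ᴷ z))))

unit≢0 : ∀ {d} (u v : ℚ[√ d ]) → u *ᴷ v ≡ 1ᴷ → u ≢ 0ᴷ
unit≢0 u v uv≡1 u≡0 = 1≢0 (cong rat (trans (sym uv≡1) (trans (cong (_*ᴷ v) u≡0) (*ᴷ-zeroˡ v))))

-- Integrality turns a strict decrease of the value into a decrease of its bound by one, which
-- drives the recursion of `descend`.
integer-<-pred : ∀ {x y} m → Integer x → Integer y → x < y → y < fromℕ (suc m) → x < fromℕ m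
integer-<-pred m (i , refl) (j , refl) i<j j<1+m = fromℤ-mono-< {i} {+ m}
  (ℤ.<-≤-trans (fromℤ-cancel-< {i} {j} i<j) (ℤ.i<j⇒i≤pred[j] (fromℤ-cancel-< {j} {+ suc m} j<1+m)))

integer-bound : ∀ {x} → Integer x → ∃ λ m → x < fromℕ m
integer-bound (+ m , refl)        = suc m , fromℤ-mono-< {+ m} {+ suc m} (ℤ.+<+ (ℕ.n<1+n m))
integer-bound (ℤ.-[1+ m ] , refl) = 0 , fromℤ-mono-< {ℤ.-[1+ m ]} {ℤ.0ℤ} ℤ.-<+

-- The conditions on trace and norm under which the unit ε generates a reduction domain.
UnitTrace : ℤ → ℤ → Set
UnitTrace t n = (n ≡ ℤ.-1ℤ × ℤ.0ℤ ℤ.< t) ⊎ (n ≡ ℤ.1ℤ × + 4 ℤ.≤ t)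

unitTrace⇒±1 : ∀ {t n} → UnitTrace t n → PlusMinusOne n
unitTrace⇒±1 (inj₁ (n≡-1 , _)) = inj₂ n≡-1
unitTrace⇒±1 (inj₂ (n≡1 , _))  = inj₁ n≡1

-- ℤ[ε] for ε = r + s√d of trace t and norm n.
module _ {d : ℕ} (r s : ℚ) (t n : ℤ) (trace-ε : 2ℚ * r ≡ fromℤ t)
  (norm-ε : r * r - fromℕ d * (s * s) ≡ fromℤ n) where

  private
    d′ = fromℕ d
    t′ = fromℤ t
    n′ = fromℤ n

    t∈ : Integer t′
    t∈ = integer-fromℤ t

    n∈ : Integer n′
    n∈ = integer-fromℤ n

  infix 5 _+ε_
  _+ε_ : ℚ → ℚ → ℚ[√ d ]
  K +ε N = ⟨ K + N * r , N * s ⟩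

  ℤ[ε] : ℚ[√ d ] → Set
  ℤ[ε] x = ∃₂ λ K N → Integer K × Integer N × x ≡ (K +ε N)

  +ε-*ᴷ : ∀ K N K₁ N₁ → (K +ε N) *ᴷ (K₁ +ε N₁)
    ≡ (K * K₁ - n′ * (N * N₁) +ε K * N₁ + N * K₁ + t′ * (N * N₁))
  +ε-*ᴷ K N K₁ N₁ = trans (cong₂ ⟨_,_⟩ (rat-lemma d′ r s K N K₁ N₁) (irr-lemma r s K N K₁ N₁))
    (cong₂ (λ t n → K * K₁ - n * (N * N₁) +ε K * N₁ + N * K₁ + t * (N * N₁)) trace-ε norm-ε)
    where
    rat-lemma : ∀ d r s K N K₁ N₁ → (K + N * r) * (K₁ + N₁ * r) + d * (N * s * (N₁ * s))
      ≡ K * K₁ - (r * r - d * (s * s)) * (N * N₁) + (K * N₁ + N * K₁ + 2ℚ * r * (N * N₁)) * r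
    rat-lemma = solve 7 (λ d r s K N K₁ N₁ → (K :+ N :* r) :* (K₁ :+ N₁ :* r) :+ d :* (N :* s :* (N₁
      :* s)) := K :* K₁ :- (r :* r :- d :* (s :* s)) :* (N :* N₁) :+ (K :* N₁ :+ N :* K₁ :+ con 2ℚ
      :* r :* (N :* N₁)) :* r) refl
    irr-lemma : ∀ r s K N K₁ N₁ → (K + N * r) * (N₁ * s) + N * s * (K₁ + N₁ * r)
      ≡ (K * N₁ + N * K₁ + 2ℚ * r * (N * N₁)) * s
    irr-lemma = solve 6 (λ r s K N K₁ N₁ → (K :+ N :* r) :* (N₁ :* s) :+ N :* s :* (K₁ :+ N₁ :* r)
      := (K :* N₁ :+ N :* K₁ :+ con 2ℚ :* r :* (N :* N₁)) :* s) refl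

  ℤ[ε]-*ᴷ : ∀ {x y} → ℤ[ε] x → ℤ[ε] y → ℤ[ε] (x *ᴷ y)
  ℤ[ε]-*ᴷ (K , N , K∈ , N∈ , refl) (K₁ , N₁ , K₁∈ , N₁∈ , refl) =
    K * K₁ - n′ * (N * N₁) , K * N₁ + N * K₁ + t′ * (N * N₁) ,
    integer-- (integer-* K∈ K₁∈) (integer-* n∈ (integer-* N∈ N₁∈)) ,
    integer-+ (integer-+ (integer-* K∈ N₁∈) (integer-* N∈ K₁∈)) (integer-* t∈ (integer-* N∈ N₁∈)) ,
    +ε-*ᴷ K N K₁ N₁

  -- K + Nε is a root of its characteristic polynomial X² - (2K + tN) X + (K² + tKN + nN²).
  ℤ[ε]⇒integral : ∀ {x} → ℤ[ε] x → Integral x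
  ℤ[ε]⇒integral (K , N , K∈ , N∈ , refl) = value c₀ ∷ value c₁ ∷ [] , (begin
    evalMonic (value c₀ ∷ value c₁ ∷ []) (K +ε N)
      ≡⟨ cong₂ (λ u v → ι u +ᴷ (K +ε N) *ᴷ (ι v +ᴷ (K +ε N) *ᴷ 1ᴷ)) (equality c₀) (equality c₁) ⟨
    ι (K * K + t′ * (K * N) + n′ * (N * N)) +ᴷ (K +ε N) *ᴷ (ι (0ℚ - (K + K + t′ * N)) +ᴷ (K +ε N) *ᴷ 1ᴷ)
      ≡⟨ cong₂ (λ t n → ι (K * K + t * (K * N) + n * (N * N)) +ᴷ (K +ε N) *ᴷ
        (ι (0ℚ - (K + K + t * N)) +ᴷ (K +ε N) *ᴷ 1ᴷ)) trace-ε norm-ε ⟨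
    ι (K * K + 2ℚ * r * (K * N) + (r * r - d′ * (s * s)) * (N * N)) +ᴷ (K +ε N) *ᴷ
      (ι (0ℚ - (K + K + 2ℚ * r * N)) +ᴷ (K +ε N) *ᴷ 1ᴷ)
      ≡⟨ cong₂ ⟨_,_⟩ (rat-lemma d′ r s K N) (irr-lemma d′ r s K N) ⟩
    0ᴷ ∎)
    where
    open ≡-Reasoning
    c₀ : Integer (K * K + t′ * (K * N) + n′ * (N * N))
    c₀ = integer-+ (integer-+ (integer-* K∈ K∈) (integer-* t∈ (integer-* K∈ N∈)))
      (integer-* n∈ (integer-* N∈ N∈))
    c₁ : Integer (0ℚ - (K + K + t′ * N))
    c₁ = integer-- (integer-fromℤ ℤ.0ℤ) (integer-+ (integer-+ K∈ K∈) (integer-* t∈ N∈))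
    rat-lemma : ∀ d r s K N → K * K + 2ℚ * r * (K * N) + (r * r - d * (s * s)) * (N * N)
      + ((K + N * r) * (0ℚ - (K + K + 2ℚ * r * N) + ((K + N * r) * 1ℚ + d * (N * s * 0ℚ)))
         + d * (N * s * (0ℚ + ((K + N * r) * 0ℚ + N * s * 1ℚ)))) ≡ 0ℚ
    rat-lemma = solve 5 (λ d r s K N → K :* K :+ con 2ℚ :* r :* (K :* N) :+ (r :* r :- d :* (s :*
      s)) :* (N :* N) :+ ((K :+ N :* r) :* (con 0ℚ :- (K :+ K :+ con 2ℚ :* r :* N) :+ ((K :+ N :* r)
      :* con 1ℚ :+ d :* (N :* s :* con 0ℚ))) :+ d :* (N :* s :* (con 0ℚ :+ ((K :+ N :* r) :* con 0ℚ
      :+ N :* s :* con 1ℚ)))) := con 0ℚ) refl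
    irr-lemma : ∀ d r s K N → 0ℚ + ((K + N * r) * (0ℚ + ((K + N * r) * 0ℚ + N * s * 1ℚ))
      + N * s * (0ℚ - (K + K + 2ℚ * r * N) + ((K + N * r) * 1ℚ + d * (N * s * 0ℚ)))) ≡ 0ℚ
    irr-lemma = solve 5 (λ d r s K N → con 0ℚ :+ ((K :+ N :* r) :* (con 0ℚ :+ ((K :+ N :* r) :* con
      0ℚ :+ N :* s :* con 1ℚ)) :+ N :* s :* (con 0ℚ :- (K :+ K :+ con 2ℚ :* r :* N) :+ ((K :+ N :*
      r) :* con 1ℚ :+ d :* (N :* s :* con 0ℚ)))) := con 0ℚ) refl

  value-quadratic : ∀ w K N → value-at w (K +ε N) ≡ quadratic (Tr w) (Tr (w *ᴷ (0ℚ +ε 1ℚ))) t′ n′ K N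
  value-quadratic w@(⟨ p , q ⟩) K N = begin
    value-at w (K +ε N)     ≡⟨ Tr≡2rat (w *ᴷ ((K +ε N) *ᴷ (K +ε N))) ⟩
    2ℚ * rat (w *ᴷ ((K +ε N) *ᴷ (K +ε N)))   ≡⟨ lemma d′ r s p q K N ⟩
    quadratic (2ℚ * rat w) (2ℚ * rat (w *ᴷ (0ℚ +ε 1ℚ))) (2ℚ * r) (r * r - d′ * (s * s)) K N
      ≡⟨ cong₂ (λ t n → quadratic (2ℚ * rat w) (2ℚ * rat (w *ᴷ (0ℚ +ε 1ℚ))) t n K N) trace-ε norm-ε ⟩
    quadratic (2ℚ * rat w) (2ℚ * rat (w *ᴷ (0ℚ +ε 1ℚ))) t′ n′ K N
      ≡⟨ cong₂ (λ α β → quadratic α β t′ n′ K N) (Tr≡2rat w) (Tr≡2rat (w *ᴷ (0ℚ +ε 1ℚ))) ⟨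
    quadratic (Tr w) (Tr (w *ᴷ (0ℚ +ε 1ℚ))) t′ n′ K N ∎
    where
    open ≡-Reasoning
    lemma : ∀ d r s p q K N →
      2ℚ * (p * ((K + N * r) * (K + N * r) + d * (N * s * (N * s))) + d *
        (q * ((K + N * r) * (N * s) + N * s * (K + N * r))))
      ≡ K * K * (2ℚ * p) + 2ℚ * (K * N * (2ℚ * (p * (0ℚ + 1ℚ * r) + d * (q * (1ℚ * s)))))
        + N * N * (2ℚ * r * (2ℚ * (p * (0ℚ + 1ℚ * r) + d * (q * (1ℚ * s)))) - (r * r - d * (s * s)) *
          (2ℚ * p))
    lemma = solve 7 (λ d r s p q K N → con 2ℚ :* (p :* ((K :+ N :* r) :* (K :+ N :* r) :+ d :* (N :*
      s :* (N :* s))) :+ d :* (q :* ((K :+ N :* r) :* (N :* s) :+ N :* s :* (K :+ N :* r)))) := K :*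
      K :* (con 2ℚ :* p) :+ con 2ℚ :* (K :* N :* (con 2ℚ :* (p :* (con 0ℚ :+ con 1ℚ :* r) :+ d :* (q
      :* (con 1ℚ :* s))))) :+ N :* N :* (con 2ℚ :* r :* (con 2ℚ :* (p :* (con 0ℚ :+ con 1ℚ :* r) :+
      d :* (q :* (con 1ℚ :* s)))) :- (r :* r :- d :* (s :* s)) :* (con 2ℚ :* p))) refl

  private
    ε ε̄ : ℚ[√ d ]
    ε = 0ℚ +ε 1ℚ
    ε̄ = t′ +ε - 1ℚ

  ℤ[ε]-unit : ℚ[√ d ] → Set
  ℤ[ε]-unit u = ℤ[ε] u × ∃ λ v → ℤ[ε] v × u *ᴷ v ≡ 1ᴷ

  ℤ[ε]-unit-*ᴷ : ∀ {u v} → ℤ[ε]-unit u → ℤ[ε]-unit v → ℤ[ε]-unit (u *ᴷ v)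
  ℤ[ε]-unit-*ᴷ {u} {v} (u∈ , u⁻¹ , u⁻¹∈ , u-inv) (v∈ , v⁻¹ , v⁻¹∈ , v-inv) =
    ℤ[ε]-*ᴷ u∈ v∈ , u⁻¹ *ᴷ v⁻¹ , ℤ[ε]-*ᴷ u⁻¹∈ v⁻¹∈ ,
    trans (*ᴷ-interchange u v u⁻¹ v⁻¹) (trans (cong₂ _*ᴷ_ u-inv v-inv) (*ᴷ-identityˡ 1ᴷ))

  1ᴷ∈ℤ[ε] : ℤ[ε] 1ᴷ
  1ᴷ∈ℤ[ε] = 1ℚ , 0ℚ , integer-fromℤ ℤ.1ℤ , integer-fromℤ ℤ.0ℤ , cong₂ ⟨_,_⟩ (lemma r) (sym (*-zeroˡ s))
    where
    lemma : ∀ r → 1ℚ ≡ 1ℚ + 0ℚ * r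
    lemma = solve 1 (λ r → con 1ℚ := con 1ℚ :+ con 0ℚ :* r) refl

  1ᴷ-unit : ℤ[ε]-unit 1ᴷ
  1ᴷ-unit = 1ᴷ∈ℤ[ε] , 1ᴷ , 1ᴷ∈ℤ[ε] , *ᴷ-identityˡ 1ᴷ

  ε∈ : ℤ[ε] ε
  ε∈ = 0ℚ , 1ℚ , integer-fromℤ ℤ.0ℤ , integer-fromℤ ℤ.1ℤ , refl

  ε̄∈ : ℤ[ε] ε̄
  ε̄∈ = t′ , - 1ℚ , t∈ , integer-fromℤ ℤ.-1ℤ , refl

  ε*ε̄ : ε *ᴷ ε̄ ≡ ι n′
  ε*ε̄ = trans (cong₂ ⟨_,_⟩
      (trans (cong (λ t → (0ℚ + 1ℚ * r) * (t + - 1ℚ * r) + d′ * (1ℚ * s * (- 1ℚ * s))) (sym trace-ε))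
        (rat-lemma d′ r s))
      (trans (cong (λ t → (0ℚ + 1ℚ * r) * (- 1ℚ * s) + 1ℚ * s * (t + - 1ℚ * r)) (sym trace-ε))
        (irr-lemma r s)))
    (cong (ι {d}) norm-ε)
    where
    rat-lemma : ∀ d r s → (0ℚ + 1ℚ * r) * (2ℚ * r + - 1ℚ * r) + d * (1ℚ * s * (- 1ℚ * s))
      ≡ r * r - d * (s * s)
    rat-lemma = solve 3 (λ d r s → (con 0ℚ :+ con 1ℚ :* r) :* (con 2ℚ :* r :+ :- con 1ℚ :* r) :+ d
      :* (con 1ℚ :* s :* (:- con 1ℚ :* s)) := r :* r :- d :* (s :* s)) refl
    irr-lemma : ∀ r s → (0ℚ + 1ℚ * r) * (- 1ℚ * s) + 1ℚ * s * (2ℚ * r + - 1ℚ * r) ≡ 0ℚ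
    irr-lemma = solve 2 (λ r s → (con 0ℚ :+ con 1ℚ :* r) :* (:- con 1ℚ :* s) :+ con 1ℚ :* s :* (con
      2ℚ :* r :+ :- con 1ℚ :* r) := con 0ℚ) refl

  ι-fromℤ∈ : ∀ i → ℤ[ε] (ι (fromℤ i))
  ι-fromℤ∈ i = fromℤ i , 0ℚ , integer-fromℤ i , integer-fromℤ ℤ.0ℤ ,
    cong₂ ⟨_,_⟩ (lemma (fromℤ i) r) (sym (*-zeroˡ s))
    where
    lemma : ∀ i r → i ≡ i + 0ℚ * r
    lemma = solve 2 (λ i r → i := i :+ con 0ℚ :* r) refl

  -- For z = K + Nε, Tr (az) = K Tr a + N Tr (aε), so the product of two denominators clears all
  -- these traces.
  integer-Tr : ∀ a {δ₁ δ₂} → Integer (Tr a * fromℤ δ₁) → Integer (Tr (a *ᴷ ε) * fromℤ δ₂) →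
    ∀ {z} → ℤ[ε] z → Integer (fromℤ (δ₁ ℤ.* δ₂) * Tr (a *ᴷ z))
  integer-Tr a@(⟨ p , q ⟩) {δ₁} {δ₂} α∈ β∈ (K , N , K∈ , N∈ , refl) = subst Integer (begin
      K * (Tr a * fromℤ δ₁ * fromℤ δ₂) + N * (Tr (a *ᴷ ε) * fromℤ δ₂ * fromℤ δ₁)
        ≡⟨ cong₂ (λ α β → K * (α * fromℤ δ₁ * fromℤ δ₂) + N * (β * fromℤ δ₂ * fromℤ δ₁)) (Tr≡2rat a)
          (Tr≡2rat (a *ᴷ ε)) ⟩
      K * (2ℚ * p * fromℤ δ₁ * fromℤ δ₂) + N * (2ℚ * rat (a *ᴷ ε) * fromℤ δ₂ * fromℤ δ₁)
        ≡⟨ lemma d′ r s p q K N (fromℤ δ₁) (fromℤ δ₂) ⟩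
      fromℤ δ₁ * fromℤ δ₂ * (2ℚ * rat (a *ᴷ (K +ε N)))
        ≡⟨ cong₂ _*_ (fromℤ-homo-* δ₁ δ₂) (Tr≡2rat (a *ᴷ (K +ε N))) ⟨
      fromℤ (δ₁ ℤ.* δ₂) * Tr (a *ᴷ (K +ε N)) ∎)
    (integer-+ (integer-* K∈ (integer-* α∈ (integer-fromℤ δ₂)))
      (integer-* N∈ (integer-* β∈ (integer-fromℤ δ₁))))
    where
    open ≡-Reasoning
    lemma : ∀ d r s p q K N x y →
      K * (2ℚ * p * x * y) + N * (2ℚ * (p * (0ℚ + 1ℚ * r) + d * (q * (1ℚ * s))) * y * x)
      ≡ x * y * (2ℚ * (p * (K + N * r) + d * (q * (N * s))))
    lemma = solve 9 (λ d r s p q K N x y → K :* (con 2ℚ :* p :* x :* y) :+ N :* (con 2ℚ :* (p :*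
      (con 0ℚ :+ con 1ℚ :* r) :+ d :* (q :* (con 1ℚ :* s))) :* y :* x) := x :* y :* (con 2ℚ :* (p :*
      (K :+ N :* r) :+ d :* (q :* (N :* s))))) refl

  CommonDenominator : ℚ[√ d ] → ℤ → Set
  CommonDenominator a D = ∀ {z} → ℤ[ε] z → Integer (fromℤ D * Tr (a *ᴷ z))

  common-denominator : ∀ a → ∃ λ D → 0ℚ < fromℤ D × CommonDenominator a D
  common-denominator a = ↧ α ℤ.* ↧ β ,
    subst (0ℚ <_) (sym (fromℤ-homo-* (↧ α) (↧ β))) (0<* (0<fromℤ↧ α) (0<fromℤ↧ β)) ,
    λ {z} → integer-Tr a {↧ α} {↧ β} (↥ α , sym (fromℤ-↥ α)) (↥ β , sym (fromℤ-↥ β)) {z}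
    where
    α = Tr a
    β = Tr (a *ᴷ ε)

  module _ (±1 : PlusMinusOne n) where

    n²≡1 : ι {d} n′ *ᴷ ι n′ ≡ 1ᴷ
    n²≡1 = cong₂ ⟨_,_⟩ (trans (rat-lemma d′ n′) (n′² ±1)) (irr-lemma n′)
      where
      rat-lemma : ∀ d n → n * n + d * (0ℚ * 0ℚ) ≡ n * n
      rat-lemma = solve 2 (λ d n → n :* n :+ d :* (con 0ℚ :* con 0ℚ) := n :* n) refl
      irr-lemma : ∀ n → n * 0ℚ + 0ℚ * n ≡ 0ℚ
      irr-lemma = solve 1 (λ n → n :* con 0ℚ :+ con 0ℚ :* n := con 0ℚ) refl
      n′² : PlusMinusOne n → n′ * n′ ≡ 1ℚ
      n′² (inj₁ refl) = refl
      n′² (inj₂ refl) = refl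

    -- Since n² = 1, the element y n inverts x.
    unit-of-norm : ∀ x y → ℤ[ε] x → ℤ[ε] y → x *ᴷ y ≡ ι n′ → ℤ[ε]-unit x
    unit-of-norm x y x∈ y∈ eq = x∈ , y *ᴷ ι n′ , ℤ[ε]-*ᴷ y∈ (ι-fromℤ∈ n) ,
      trans (sym (*ᴷ-assoc x y (ι n′))) (trans (cong (_*ᴷ ι n′) eq) n²≡1)

    ε-unit : ℤ[ε]-unit ε
    ε-unit = unit-of-norm ε ε̄ ε∈ ε̄∈ ε*ε̄

    ε̄-unit : ℤ[ε]-unit ε̄
    ε̄-unit = unit-of-norm ε̄ ε ε̄∈ ε∈ (trans (*ᴷ-comm ε̄ ε) ε*ε̄)

    module _ (a : ℚ[√ d ]) where

      Reduced : ℚ[√ d ] → Set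
      Reduced u = value-at a u ≤ value-at a (u *ᴷ ε) × value-at a u ≤ value-at a (u *ᴷ ε̄)

      -- The recursion is on a bound m for the nonnegative integer D · `value-at a u`. A step to uε
      -- or uε̄ is taken only if it lowers the value; when neither does, u is reduced.
      descend : ∀ D → CommonDenominator a D → 0ℚ < fromℤ D → (∀ x → 0ℚ ≤ value-at a x) →
        ∀ m u → ℤ[ε]-unit u → fromℤ D * value-at a u < fromℕ m → ∃ λ u → ℤ[ε]-unit u × Reduced u
      descend D common 0<D nonNeg zero u u-unit D*u<m =
        contradiction (≤-<-trans (0≤* (<⇒≤ 0<D) (nonNeg u)) D*u<m) (<-irrefl refl)
      descend D common 0<D nonNeg (suc m) u u-unit D*u<m =
        choose (value-at a (u *ᴷ ε) <? value-at a u) (value-at a (u *ᴷ ε̄) <? value-at a u)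
        where
        smaller : ∀ e → ℤ[ε]-unit e → value-at a (u *ᴷ e) < value-at a u → ∃ λ u →
          ℤ[ε]-unit u × Reduced u
        smaller e e-unit lt = descend D common 0<D nonNeg m (u *ᴷ e) ue-unit
          (integer-<-pred m (common (ℤ[ε]-*ᴷ (proj₁ ue-unit) (proj₁ ue-unit)))
                          (common (ℤ[ε]-*ᴷ (proj₁ u-unit) (proj₁ u-unit)))
                          (*-monoʳ-<-pos (fromℤ D) {{positive 0<D}} lt) D*u<m)
          where ue-unit = ℤ[ε]-unit-*ᴷ u-unit e-unit
        choose : Dec (value-at a (u *ᴷ ε) < value-at a u) → Dec (value-at a (u *ᴷ ε̄) < value-at a u) →
          ∃ λ u → ℤ[ε]-unit u × Reduced u
        choose (yes lt) _        = smaller ε ε-unit lt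
        choose (no _)   (yes lt) = smaller ε̄ ε̄-unit lt
        choose (no p)   (no q)   = u , u-unit , ≮⇒≥ p , ≮⇒≥ q

      reduced-unit : TotallyPositive a → ∃ λ u → ℤ[ε]-unit u × Reduced u
      reduced-unit tp = go (common-denominator a)
        where
        go : (∃ λ D → 0ℚ < fromℤ D × CommonDenominator a D) → ∃ λ u → ℤ[ε]-unit u × Reduced u
        go (D , 0<D , common) = descend D common 0<D (Tr-square-nonNeg a tp) (proj₁ bound) 1ᴷ 1ᴷ-unit
          (proj₂ bound)
          where bound = integer-bound (common (ℤ[ε]-*ᴷ 1ᴷ∈ℤ[ε] 1ᴷ∈ℤ[ε]))

  reduced-quadratic : ∀ α β → UnitTrace t n → α ≤ quadratic α β t′ n′ 0ℚ 1ℚ →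
    α ≤ quadratic α β t′ n′ t′ (- 1ℚ) →
    ∀ i j → NonZeroPair i j → α ≤ quadratic α β t′ n′ (fromℤ i) (fromℤ j)
  reduced-quadratic α β (inj₁ (refl , 0<t)) h₁ h₂ i j nz =
    reduced-norm-1 α β t i j nz (fromℤ-mono-< {ℤ.0ℤ} {t} 0<t) h₁ h₂
  reduced-quadratic α β (inj₂ (refl , 4≤t)) h₁ h₂ i j nz =
    reduced-norm+1 α β t i j nz (fromℤ-mono-≤ {+ 4} {t} 4≤t) h₁ h₂

  module _ (unit-trace : UnitTrace t n) (integral⇒ℤ[ε] : ∀ x → Integral x → ℤ[ε] x) where

    -- Divide by u: as x = u (vx), the value of a at x is the value of `w` = au² at vx = K + Nε.
    -- There u becomes 1, and the two inequalities of `Reduced` become the hypotheses at ε and ε̄ of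
    -- the bound for `quadratic`.
    reduced-minimal : ∀ a u → ℤ[ε]-unit u → Reduced (unitTrace⇒±1 unit-trace) a u →
      ∀ x → ℤ[ε] x → x ≢ 0ᴷ → value-at a u ≤ value-at a x
    reduced-minimal a u (u∈ , v , v∈ , uv≡1) (h₁ , h₂) x x∈ x≢0 =
      subst (λ z → value-at a u ≤ value-at a z) u[vx]≡x (multiple (ℤ[ε]-*ᴷ v∈ x∈) vx≢0)
      where
      w = a *ᴷ (u *ᴷ u)
      β = Tr (w *ᴷ ε)
      u[vx]≡x : u *ᴷ (v *ᴷ x) ≡ x
      u[vx]≡x = trans (sym (*ᴷ-assoc u v x)) (trans (cong (_*ᴷ x) uv≡1) (*ᴷ-identityˡ x))
      vx≢0 : v *ᴷ x ≢ 0ᴷ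
      vx≢0 vx≡0 = x≢0 (trans (sym u[vx]≡x)
        (trans (cong (u *ᴷ_) vx≡0) (trans (*ᴷ-comm u 0ᴷ) (*ᴷ-zeroˡ u))))
      to-quadratic : ∀ K N → value-at a (u *ᴷ (K +ε N)) ≡ quadratic (Tr w) β t′ n′ K N
      to-quadratic K N = trans (value-at-*ᴷ a u (K +ε N)) (value-quadratic w K N)
      zero-sum : 0ℚ +ε 0ℚ ≡ 0ᴷ
      zero-sum = cong₂ ⟨_,_⟩ (trans (+-identityˡ (0ℚ * r)) (*-zeroˡ r)) (*-zeroˡ s)
      multiple : ∀ {z} → ℤ[ε] z → z ≢ 0ᴷ → value-at a u ≤ value-at a (u *ᴷ z)
      multiple (K , N , (i , refl) , (j , refl) , refl) z≢0 =
        subst (value-at a u ≤_) (sym (to-quadratic K N))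
        (reduced-quadratic (Tr w) β unit-trace
          (subst (value-at a u ≤_) (to-quadratic 0ℚ 1ℚ) h₁)
          (subst (value-at a u ≤_) (to-quadratic t′ (- 1ℚ)) h₂) i j
          λ { (refl , refl) → z≢0 zero-sum })

    -- The reduced unit attains both minima: units are nonzero integers, so minimality over the
    -- latter covers the former.
    unitTrace⇒unitReducible : UnitReducible d
    unitTrace⇒unitReducible a tp = go (reduced-unit (unitTrace⇒±1 unit-trace) a tp)
      where
      go : (∃ λ u → ℤ[ε]-unit u × Reduced (unitTrace⇒±1 unit-trace) a u) →
        ∃ λ μ → IsMinimumOver NonZeroInteger (value-at a) μ × IsMinimumOver IntegralUnit (value-at a) μ
      go (u , u-unit@(u∈ , v , v∈ , uv≡1) , reduced) = value-at a u ,
        ((u , (ℤ[ε]⇒integral u∈ , unit≢0 u v uv≡1) , refl) ,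
          λ x (x∈O , x≢0) → reduced-minimal a u u-unit reduced x (integral⇒ℤ[ε] x x∈O) x≢0) ,
        ((u , (ℤ[ε]⇒integral u∈ , v , ℤ[ε]⇒integral v∈ , uv≡1) , refl) ,
          λ x (x∈O , y , _ , xy≡1) → reduced-minimal a u u-unit reduced x (integral⇒ℤ[ε] x x∈O)
            (unit≢0 x y xy≡1))

-- Congruences modulo 4 and the shape of the ring of integers.

fromℕ-homo-+ : ∀ m n → fromℕ (m ℕ.+ n) ≡ fromℕ m + fromℕ n
fromℕ-homo-+ m n = fromℤ-homo-+ (+ m) (+ n)

fromℕ-homo-* : ∀ m n → fromℕ (m ℕ.* n) ≡ fromℕ m * fromℕ n
fromℕ-homo-* m n = trans (cong fromℤ (ℤ.pos-* m n)) (fromℤ-homo-* (+ m) (+ n))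

even⊎odd : ∀ i → (∃ λ j → i ≡ + 2 ℤ.* j) ⊎ (∃ λ j → i ≡ + 2 ℤ.* j ℤ.+ ℤ.1ℤ)
even⊎odd i = go (i %ℕ 2) (n%ℕd<d i 2) (a≡a%ℕn+[a/ℕn]*n i 2)
  where
  even : ∀ j → ℤ.0ℤ ℤ.+ j ℤ.* + 2 ≡ + 2 ℤ.* j
  even = solve-∀
  odd : ∀ j → ℤ.1ℤ ℤ.+ j ℤ.* + 2 ≡ + 2 ℤ.* j ℤ.+ ℤ.1ℤ
  odd = solve-∀
  go : ∀ e → e ℕ.< 2 → i ≡ + e ℤ.+ (i /ℕ 2) ℤ.* + 2 →
    (∃ λ j → i ≡ + 2 ℤ.* j) ⊎ (∃ λ j → i ≡ + 2 ℤ.* j ℤ.+ ℤ.1ℤ)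
  go 0 _ eq = inj₁ (i /ℕ 2 , trans eq (even (i /ℕ 2)))
  go 1 _ eq = inj₂ (i /ℕ 2 , trans eq (odd (i /ℕ 2)))
  go (suc (suc e)) (s≤s (s≤s ())) _

odd-ℕ : ∀ m → ¬ (2 ∣ m) → ∃ λ l → + m ≡ + 2 ℤ.* l ℤ.+ ℤ.1ℤ
odd-ℕ m m-odd = [ (λ (j , eq) → contradiction (divides ℤ.∣ j ∣ (trans (cong ℤ.∣_∣ eq)
    (trans (ℤ.abs-* (+ 2) j) (ℕ.*-comm 2 ℤ.∣ j ∣)))) m-odd) , (λ odd → odd) ]′ (even⊎odd (+ m))

even-ℕ : ∀ {m} → 2 ∣ m → ∃ λ l → + m ≡ + 2 ℤ.* l
even-ℕ (divides q refl) = + q , trans (cong +_ (ℕ.*-comm q 2)) (ℤ.pos-* 2 q)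

*≡⇒∣ : ∀ k z c → + k ℤ.* z ≡ c → k ∣ ℤ.∣ c ∣
*≡⇒∣ k z c eq = divides ℤ.∣ z ∣
  (trans (cong ℤ.∣_∣ (sym eq)) (trans (ℤ.abs-* (+ k) z) (ℕ.*-comm k ℤ.∣ z ∣)))

-- Form in which congruences are refuted below: a ring identity writes c plus a vanishing difference
-- as a multiple of k, although k does not divide c.
≡-mod⇒∣ : ∀ k z c {x y} → + k ℤ.* z ≡ c ℤ.+ (x ℤ.- y) → x ≡ y → k ∣ ℤ.∣ c ∣
≡-mod⇒∣ k z c {x} {y} eq x≡y =
  *≡⇒∣ k z c (trans eq (trans (cong (λ e → c ℤ.+ e) (ℤ.i≡j⇒i-j≡0 x≡y)) (ℤ.+-identityʳ c)))

halve : ∀ p → 1ℚ * p ≡ ½ * (2ℚ * p)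
halve = solve 1 (λ p → con 1ℚ :* p := con ½ :* (con 2ℚ :* p)) refl

half-even : ∀ p {i} j → 2ℚ * p ≡ fromℤ i → i ≡ + 2 ℤ.* j → 1ℚ * p ≡ fromℤ j
half-even p j eq refl = begin
  1ℚ * p                    ≡⟨ halve p ⟩
  ½ * (2ℚ * p)              ≡⟨ cong (½ *_) (trans eq (fromℤ-homo-* (+ 2) j)) ⟩
  ½ * (2ℚ * fromℤ j)        ≡⟨ halve (fromℤ j) ⟨
  1ℚ * fromℤ j              ≡⟨ *-identityˡ (fromℤ j) ⟩
  fromℤ j                   ∎
  where open ≡-Reasoning

-- Here d ≡ e + 1 modulo 4. With this encoding, d ≢ 1 and d ≢ 0 become the facts that 4 divides
-- neither e nor `suc e`.
TwoOrThreeMod4 : ℕ → Set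
TwoOrThreeMod4 d = ∃₂ λ e D → (e ≡ 1 ⊎ e ≡ 2) × + d ≡ + suc e ℤ.+ + 4 ℤ.* D

¬4∣ : ∀ {e} → e ≡ 1 ⊎ e ≡ 2 → ¬ (4 ∣ e)
¬4∣ (inj₁ refl) = from-no (4 ∣? 1)
¬4∣ (inj₂ refl) = from-no (4 ∣? 2)

¬4∣suc : ∀ {e} → e ≡ 1 ⊎ e ≡ 2 → ¬ (4 ∣ suc e)
¬4∣suc (inj₁ refl) = from-no (4 ∣? 2)
¬4∣suc (inj₂ refl) = from-no (4 ∣? 3)

-- Modulo 4 the equation is a² ≡ d b², and squares are 0 or 1. The three cases other than both even
-- give 1 ≡ 0, 0 ≡ d and 1 ≡ d.
both-even : ∀ {d} → TwoOrThreeMod4 d → ∀ a b n → a ℤ.* a ≡ + d ℤ.* (b ℤ.* b) ℤ.+ + 2 ℤ.* + 2 ℤ.* n →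
  (∃ λ i → a ≡ + 2 ℤ.* i) × (∃ λ j → b ≡ + 2 ℤ.* j)
both-even {d} (e , D , e≡ , d≡) a b n eq = go (even⊎odd a) (even⊎odd b)
  where
  go : (∃ λ i → a ≡ + 2 ℤ.* i) ⊎ (∃ λ i → a ≡ + 2 ℤ.* i ℤ.+ ℤ.1ℤ) →
    (∃ λ j → b ≡ + 2 ℤ.* j) ⊎ (∃ λ j → b ≡ + 2 ℤ.* j ℤ.+ ℤ.1ℤ) →
    (∃ λ i → a ≡ + 2 ℤ.* i) × (∃ λ j → b ≡ + 2 ℤ.* j)
  go (inj₁ even)       (inj₁ even′)      = even , even′
  go (inj₂ (i , refl)) (inj₁ (j , refl)) = contradiction (≡-mod⇒∣ 4 _ ℤ.-1ℤ (lemma i j n (+ d)) eq)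
    (from-no (4 ∣? 1))
    where
    lemma : ∀ i j n d → + 4 ℤ.* (i ℤ.* i ℤ.+ i ℤ.- d ℤ.* (j ℤ.* j) ℤ.- n) ≡ ℤ.-1ℤ ℤ.+
      ((+ 2 ℤ.* i ℤ.+ ℤ.1ℤ) ℤ.* (+ 2 ℤ.* i ℤ.+ ℤ.1ℤ) ℤ.-
        (d ℤ.* ((+ 2 ℤ.* j) ℤ.* (+ 2 ℤ.* j)) ℤ.+ + 2 ℤ.* + 2 ℤ.* n))
    lemma = solve-∀
  go (inj₁ (i , refl)) (inj₂ (j , refl)) = contradiction
    (≡-mod⇒∣ 4 _ (+ suc e) (lemma i j n (+ suc e) D) (trans eq
      (cong (λ d → d ℤ.* ((+ 2 ℤ.* j ℤ.+ ℤ.1ℤ) ℤ.* (+ 2 ℤ.* j ℤ.+ ℤ.1ℤ)) ℤ.+ + 2 ℤ.* + 2 ℤ.* n) d≡)))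
        (¬4∣suc e≡)
    where
    lemma : ∀ i j n e D → + 4 ℤ.* (i ℤ.* i ℤ.- (e ℤ.+ + 4 ℤ.* D) ℤ.* (j ℤ.* j ℤ.+ j) ℤ.- n ℤ.- D)
      ≡ e ℤ.+
      ((+ 2 ℤ.* i) ℤ.* (+ 2 ℤ.* i) ℤ.-
        ((e ℤ.+ + 4 ℤ.* D) ℤ.* ((+ 2 ℤ.* j ℤ.+ ℤ.1ℤ) ℤ.* (+ 2 ℤ.* j ℤ.+ ℤ.1ℤ)) ℤ.+ + 2 ℤ.* + 2 ℤ.* n))
    lemma = solve-∀
  go (inj₂ (i , refl)) (inj₂ (j , refl)) = contradiction
    (≡-mod⇒∣ 4 _ (+ e) (lemma i j n (+ e) D) (trans eq
      (cong (λ d → d ℤ.* ((+ 2 ℤ.* j ℤ.+ ℤ.1ℤ) ℤ.* (+ 2 ℤ.* j ℤ.+ ℤ.1ℤ)) ℤ.+ + 2 ℤ.* + 2 ℤ.* n) d≡)))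
        (¬4∣ e≡)
    where
    lemma : ∀ i j n e D →
      + 4 ℤ.* (i ℤ.* i ℤ.+ i ℤ.- (ℤ.1ℤ ℤ.+ e ℤ.+ + 4 ℤ.* D) ℤ.* (j ℤ.* j ℤ.+ j) ℤ.- n ℤ.- D) ≡ e ℤ.+
      ((+ 2 ℤ.* i ℤ.+ ℤ.1ℤ) ℤ.* (+ 2 ℤ.* i ℤ.+ ℤ.1ℤ)
       ℤ.- ((ℤ.1ℤ ℤ.+ e ℤ.+ + 4 ℤ.* D) ℤ.* ((+ 2 ℤ.* j ℤ.+ ℤ.1ℤ) ℤ.* (+ 2 ℤ.* j ℤ.+ ℤ.1ℤ)) ℤ.+ + 2 ℤ.*
         + 2 ℤ.* n))
    lemma = solve-∀

whole-coordinates : ∀ {d} → TwoOrThreeMod4 d → (x : ℚ[√ d ]) → Coordinates (+ 2) x → Coordinates (+ 1) x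
whole-coordinates mod4 x c = go (both-even mod4 (a c) (b c) (n c) (coordinates-norm c))
  where
  go : (∃ λ i → a c ≡ + 2 ℤ.* i) × (∃ λ j → b c ≡ + 2 ℤ.* j) → Coordinates (+ 1) x
  go ((i , a≡2i) , (j , b≡2j)) = coordinates {k = + 1} {x = x}
    (i , half-even (rat x) i (rat-eq c) a≡2i) (j , half-even (irr x) j (irr-eq c) b≡2j)
      (n c , norm-eq c)

module _ {d : ℕ} (m : ℕ) (n₁ : ℤ) where

  module _ (m²≡ : + m ℤ.* + m ≡ + d ℤ.+ n₁) where

    -- Here ε = m + √d, and (m + √d)/2 in the second half. The norm `n₁` may be any integer: the
    -- value ±1 gives the unit needed for sufficiency, other values the integrality of the test
    -- element x₀ in the necessity proof.
    trace₁ : 2ℚ * fromℕ m ≡ fromℤ (+ 2 ℤ.* + m)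
    trace₁ = sym (fromℤ-homo-* (+ 2) (+ m))

    norm₁ : fromℕ m * fromℕ m - fromℕ d * (1ℚ * 1ℚ) ≡ fromℤ n₁
    norm₁ = begin
      fromℕ m * fromℕ m - fromℕ d * (1ℚ * 1ℚ)   ≡⟨ cong (λ z → z - fromℕ d * (1ℚ * 1ℚ))
                                                       (trans (sym (fromℤ-homo-* (+ m) (+ m)))
                                                       (trans (cong fromℤ m²≡) (fromℤ-homo-+ (+ d) n₁)))
                                                         ⟩
      fromℕ d + fromℤ n₁ - fromℕ d * (1ℚ * 1ℚ)  ≡⟨ lemma (fromℕ d) (fromℤ n₁) ⟩
      fromℤ n₁                                   ∎
      where
      open ≡-Reasoning
      lemma : ∀ d n → d + n - d * (1ℚ * 1ℚ) ≡ n
      lemma = solve 2 (λ d n → d :+ n :- d :* (con 1ℚ :* con 1ℚ) := n) refl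

    coordinates⇒ℤ[ε]₁ : (x : ℚ[√ d ]) → Coordinates (+ 1) x →
      ℤ[ε] (fromℕ m) 1ℚ (+ 2 ℤ.* + m) n₁ trace₁ norm₁ x
    coordinates⇒ℤ[ε]₁ ⟨ p , q ⟩ record { a = a ; b = b ; rat-eq = p≡ ; irr-eq = q≡ } =
      -- a + b√d = (a - bm) + b (m + √d).
      fromℤ a - fromℤ b * fromℕ m , fromℤ b ,
      integer-- (integer-fromℤ a) (integer-* (integer-fromℤ b) (integer-fromℤ (+ m))) ,
        integer-fromℤ b ,
      cong₂ ⟨_,_⟩ (trans (sym (*-identityˡ p)) (trans p≡ (lemma (fromℤ a) (fromℤ b) (fromℕ m))))
                  (trans (sym (*-identityˡ q)) (trans q≡ (sym (*-identityʳ (fromℤ b)))))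
      where
      lemma : ∀ a b m → a ≡ a - b * m + b * m
      lemma = solve 3 (λ a b m → a := a :- b :* m :+ b :* m) refl

  module _ (m²≡ : + m ℤ.* + m ≡ + d ℤ.+ + 2 ℤ.* + 2 ℤ.* n₁) where

    trace₂ : 2ℚ * (½ * fromℕ m) ≡ fromℤ (+ m)
    trace₂ = lemma (fromℕ m)
      where
      lemma : ∀ m → 2ℚ * (½ * m) ≡ m
      lemma = solve 1 (λ m → con 2ℚ :* (con ½ :* m) := m) refl

    norm₂ : ½ * fromℕ m * (½ * fromℕ m) - fromℕ d * (½ * ½) ≡ fromℤ n₁
    norm₂ = begin
      ½ * fromℕ m * (½ * fromℕ m) - fromℕ d * (½ * ½)       ≡⟨ lemma₁ (fromℕ m) (fromℕ d) ⟩
      ½ * ½ * (fromℕ m * fromℕ m - fromℕ d)                 ≡⟨ cong (λ z → ½ * ½ * (z - fromℕ d)) (begin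
        fromℕ m * fromℕ m                            ≡⟨ fromℤ-homo-* (+ m) (+ m) ⟨
        fromℤ (+ m ℤ.* + m)                          ≡⟨ cong fromℤ m²≡ ⟩
        fromℤ (+ d ℤ.+ + 2 ℤ.* + 2 ℤ.* n₁)           ≡⟨ fromℤ-homo-+ (+ d) (+ 2 ℤ.* + 2 ℤ.* n₁) ⟩
        fromℕ d + fromℤ (+ 4 ℤ.* n₁)                 ≡⟨ cong (λ z → fromℕ d + z)
          (fromℤ-homo-* (+ 4) n₁) ⟩
        fromℕ d + 4ℚ * fromℤ n₁                      ∎) ⟩
      ½ * ½ * (fromℕ d + 4ℚ * fromℤ n₁ - fromℕ d)           ≡⟨ lemma₂ (fromℕ d) (fromℤ n₁) ⟩
      fromℤ n₁                                              ∎
      where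
      open ≡-Reasoning
      lemma₁ : ∀ m d → ½ * m * (½ * m) - d * (½ * ½) ≡ ½ * ½ * (m * m - d)
      lemma₁ = solve 2 (λ m d → con ½ :* m :* (con ½ :* m) :- d :* (con ½ :* con ½) := con ½ :* con
        ½ :* (m :* m :- d)) refl
      lemma₂ : ∀ d n → ½ * ½ * (d + 4ℚ * n - d) ≡ n
      lemma₂ = solve 2 (λ d n → con ½ :* con ½ :* (d :+ con 4ℚ :* n :- d) := n) refl

    -- (a − bm)(a + bm) is divisible by 4, and the two factors have the same parity.
    a-bm-even : ∀ a b n → a ℤ.* a ≡ + d ℤ.* (b ℤ.* b) ℤ.+ + 2 ℤ.* + 2 ℤ.* n → ∃ λ i →
      a ℤ.- b ℤ.* + m ≡ + 2 ℤ.* i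
    a-bm-even a b n eq = [ (λ even → even) ,
      (λ (i , odd) → contradiction (odd-absurd i odd) (from-no (2 ∣? 1))) ]′
      (even⊎odd (a ℤ.- b ℤ.* + m))
      where
      odd-absurd : ∀ i → a ℤ.- b ℤ.* + m ≡ + 2 ℤ.* i ℤ.+ ℤ.1ℤ → 2 ∣ 1
      odd-absurd i odd = ≡-mod⇒∣ 2 _ ℤ.1ℤ (lemma i b (+ m) n n₁) (begin
        + 2 ℤ.* (+ 2 ℤ.* (n ℤ.- n₁ ℤ.* (b ℤ.* b))) 
          ≡⟨ rearrange (+ d) n n₁ b ⟩
        (+ d ℤ.* (b ℤ.* b) ℤ.+ + 2 ℤ.* + 2 ℤ.* n) ℤ.- b ℤ.* b ℤ.* (+ d ℤ.+ + 2 ℤ.* + 2 ℤ.* n₁)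
          ≡⟨ cong₂ (λ x y → x ℤ.- b ℤ.* b ℤ.* y) eq m²≡ ⟨
        a ℤ.* a ℤ.- b ℤ.* b ℤ.* (+ m ℤ.* + m)
          ≡⟨ factor a b (+ m) ⟩
        (a ℤ.- b ℤ.* + m) ℤ.* (a ℤ.- b ℤ.* + m ℤ.+ + 2 ℤ.* (b ℤ.* + m))
          ≡⟨ cong (λ z → z ℤ.* (z ℤ.+ + 2 ℤ.* (b ℤ.* + m))) odd ⟩
        (+ 2 ℤ.* i ℤ.+ ℤ.1ℤ) ℤ.* (+ 2 ℤ.* i ℤ.+ ℤ.1ℤ ℤ.+ + 2 ℤ.* (b ℤ.* + m)) ∎)
        where
        open ≡-Reasoning
        rearrange : ∀ d n n₁ b → + 2 ℤ.* (+ 2 ℤ.* (n ℤ.- n₁ ℤ.* (b ℤ.* b)))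
          ≡ (d ℤ.* (b ℤ.* b) ℤ.+ + 2 ℤ.* + 2 ℤ.* n) ℤ.- b ℤ.* b ℤ.* (d ℤ.+ + 2 ℤ.* + 2 ℤ.* n₁)
        rearrange = solve-∀
        factor : ∀ a b m → a ℤ.* a ℤ.- b ℤ.* b ℤ.* (m ℤ.* m) ≡ (a ℤ.- b ℤ.* m) ℤ.*
          (a ℤ.- b ℤ.* m ℤ.+ + 2 ℤ.* (b ℤ.* m))
        factor = solve-∀
        lemma : ∀ i b m n n₁ →
          + 2 ℤ.* (+ 2 ℤ.* (n ℤ.- n₁ ℤ.* (b ℤ.* b)) ℤ.-
            (+ 2 ℤ.* (i ℤ.* i ℤ.+ i) ℤ.+ (+ 2 ℤ.* i ℤ.+ ℤ.1ℤ) ℤ.* (b ℤ.* m)))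
          ≡ ℤ.1ℤ ℤ.+ (+ 2 ℤ.* (+ 2 ℤ.* (n ℤ.- n₁ ℤ.* (b ℤ.* b)))
                     ℤ.- (+ 2 ℤ.* i ℤ.+ ℤ.1ℤ) ℤ.* (+ 2 ℤ.* i ℤ.+ ℤ.1ℤ ℤ.+ + 2 ℤ.* (b ℤ.* m)))
        lemma = solve-∀

    coordinates⇒ℤ[ε]₂ : (x : ℚ[√ d ]) → Coordinates (+ 2) x →
      ℤ[ε] (½ * fromℕ m) ½ (+ m) n₁ trace₂ norm₂ x
    coordinates⇒ℤ[ε]₂ x@(⟨ p , q ⟩) c = go (a-bm-even (a c) (b c) (n c) (coordinates-norm c))
      where
      go : (∃ λ i → a c ℤ.- b c ℤ.* + m ≡ + 2 ℤ.* i) → ℤ[ε] (½ * fromℕ m) ½ (+ m) n₁ trace₂ norm₂ x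
      -- (a + b√d)/2 = (a - bm)/2 + b (m + √d)/2, where i is the integer (a - bm)/2.
      go (i , even) = fromℤ i , fromℤ (b c) , integer-fromℤ i , integer-fromℤ (b c) , cong₂ ⟨_,_⟩
          (begin
            p                                                       ≡⟨ halve₀ p ⟩
            ½ * (2ℚ * p)                                            ≡⟨ cong (½ *_) (rat-eq c) ⟩
            ½ * fromℤ (a c)                                         ≡⟨ split (fromℤ (a c)) (fromℤ (b c))
              (fromℕ m) ⟩
            ½ * (fromℤ (a c) - fromℤ (b c) * fromℕ m) + fromℤ (b c) * (½ * fromℕ m)
              ≡⟨ cong (λ z → ½ * z + fromℤ (b c) * (½ * fromℕ m)) even-ℚ ⟩
            ½ * (2ℚ * fromℤ i) + fromℤ (b c) *
              (½ * fromℕ m)        ≡⟨ cong (_+ fromℤ (b c) * (½ * fromℕ m)) (halve₀ (fromℤ i)) ⟨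
            fromℤ i + fromℤ (b c) * (½ * fromℕ m)                   ∎)
          (trans (halve₀ q) (trans (cong (½ *_) (irr-eq c)) (*-comm ½ (fromℤ (b c)))))
        where
        open ≡-Reasoning
        halve₀ : ∀ p → p ≡ ½ * (2ℚ * p)
        halve₀ = solve 1 (λ p → p := con ½ :* (con 2ℚ :* p)) refl
        split : ∀ a b m → ½ * a ≡ ½ * (a - b * m) + b * (½ * m)
        split = solve 3 (λ a b m → con ½ :* a := con ½ :* (a :- b :* m) :+ b :* (con ½ :* m)) refl
        even-ℚ : fromℤ (a c) - fromℤ (b c) * fromℕ m ≡ 2ℚ * fromℤ i
        even-ℚ = begin
          fromℤ (a c) - fromℤ (b c) * fromℕ
            m       ≡⟨ cong (λ z → fromℤ (a c) - z) (fromℤ-homo-* (b c) (+ m)) ⟨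
          fromℤ (a c) - fromℤ (b c ℤ.* + m)         ≡⟨ fromℤ-homo-- (a c) (b c ℤ.* + m) ⟨
          fromℤ (a c ℤ.- b c ℤ.* + m)               ≡⟨ cong fromℤ even ⟩
          fromℤ (+ 2 ℤ.* i)                         ≡⟨ fromℤ-homo-* (+ 2) i ⟩
          2ℚ * fromℤ i                              ∎

-- Sufficiency for each of the four types.

UnitReducibleType : ℕ → Set
UnitReducibleType d =
  (∃ λ m → ¬ (2 ∣ m) × d ≡ m ℕ.^ 2 ℕ.+ 1)
  ⊎ (∃ λ m → 2 ∣ m × d ℕ.+ 1 ≡ m ℕ.^ 2)
  ⊎ (∃ λ m → ¬ (2 ∣ m) × d ≡ m ℕ.^ 2 ℕ.+ 4)
  ⊎ (∃ λ m → ¬ (2 ∣ m) × 3 ℕ.< m × d ℕ.+ 4 ≡ m ℕ.^ 2)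

pos-^2 : ∀ m → + (m ℕ.^ 2) ≡ + m ℤ.* + m
pos-^2 m = trans (cong (λ x → + (m ℕ.* x)) (ℕ.*-identityʳ m)) (ℤ.pos-* m m)

odd⇒0< : ∀ {m} → ¬ (2 ∣ m) → ℤ.0ℤ ℤ.< + m
odd⇒0< {zero}  m-odd = contradiction (divides 0 refl) m-odd
odd⇒0< {suc m} _     = ℤ.+<+ (s≤s z≤n)

d≡m²+k⇒m²≡d-k : ∀ {d} m k → d ≡ m ℕ.^ 2 ℕ.+ k → + m ℤ.* + m ≡ + d ℤ.- + k
d≡m²+k⇒m²≡d-k m k refl = trans (lemma (+ m ℤ.* + m) (+ k))
  (cong (λ x → x ℤ.+ + k ℤ.- + k) (sym (pos-^2 m)))
  where
  lemma : ∀ x k → x ≡ x ℤ.+ k ℤ.- k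
  lemma = solve-∀

d+k≡m²⇒m²≡d+k : ∀ {d} m k → d ℕ.+ k ≡ m ℕ.^ 2 → + m ℤ.* + m ≡ + d ℤ.+ + k
d+k≡m²⇒m²≡d+k m k eq = trans (sym (pos-^2 m)) (cong +_ (sym eq))

reducible-whole : ∀ {d} → SquareFree d → TwoOrThreeMod4 d → ∀ m n → UnitTrace (+ 2 ℤ.* + m) n →
  + m ℤ.* + m ≡ + d ℤ.+ n → UnitReducible d
reducible-whole sf mod4 m n unit-trace m²≡ =
  unitTrace⇒unitReducible (fromℕ m) 1ℚ (+ 2 ℤ.* + m) n (trace₁ m n m²≡) (norm₁ m n m²≡) unit-trace
    λ x x∈O → coordinates⇒ℤ[ε]₁ m n m²≡ x (whole-coordinates mod4 x (integral⇒coordinates sf x∈O))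

reducible-half : ∀ {d} → SquareFree d → ∀ m n → UnitTrace (+ m) n →
  + m ℤ.* + m ≡ + d ℤ.+ + 2 ℤ.* + 2 ℤ.* n → UnitReducible d
reducible-half sf m n unit-trace m²≡ =
  unitTrace⇒unitReducible (½ * fromℕ m) ½ (+ m) n (trace₂ m n m²≡) (norm₂ m n m²≡) unit-trace
    λ x x∈O → coordinates⇒ℤ[ε]₂ m n m²≡ x (integral⇒coordinates sf x∈O)

-- For d = m² ± 1 the unit is m + √d with trace 2m, and the parity of m places d in the classes 2
-- and 3 modulo 4. For d = m² ± 4 it is (m + √d)/2 with trace m. The norm is -1 for the sign + and 1
-- for the sign -; in the latter case the trace is at least 4, since m is even and positive,
-- respectively m > 3.
type⇒reducible : ∀ {d} → 1 ℕ.< d → SquareFree d → UnitReducibleType d → UnitReducible d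
type⇒reducible {d} _ sf (inj₁ (m , m-odd , d≡)) = reducible-whole sf
  (1 , proj₁ mod4 , inj₁ refl , proj₂ mod4) m ℤ.-1ℤ
  (inj₁ (refl , ℤ.*-monoˡ-<-pos (+ 2) (odd⇒0< m-odd))) (d≡m²+k⇒m²≡d-k m 1 d≡)
  where
  mod4 : ∃ λ D → + d ≡ + 2 ℤ.+ + 4 ℤ.* D
  mod4 with l , m≡ ← odd-ℕ m m-odd = l ℤ.* l ℤ.+ l ,
    trans (cong +_ d≡) (trans (cong (ℤ._+ ℤ.1ℤ) (trans (pos-^2 m)
      (cong₂ ℤ._*_ m≡ m≡))) (lemma l))
    where
    lemma : ∀ l → (+ 2 ℤ.* l ℤ.+ ℤ.1ℤ) ℤ.* (+ 2 ℤ.* l ℤ.+ ℤ.1ℤ) ℤ.+ ℤ.1ℤ ≡ + 2 ℤ.+ + 4 ℤ.*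
      (l ℤ.* l ℤ.+ l)
    lemma = solve-∀
type⇒reducible {d} 1<d sf (inj₂ (inj₁ (m , m-even , d≡))) = reducible-whole sf
  (2 , proj₁ mod4 , inj₂ refl , proj₂ mod4) m ℤ.1ℤ
  (inj₂ (refl , ℤ.*-monoˡ-≤-nonNeg (+ 2) (2≤m m-even d≡))) (d+k≡m²⇒m²≡d+k m 1 d≡)
  where
  2≤m : ∀ {m} → 2 ∣ m → d ℕ.+ 1 ≡ m ℕ.^ 2 → + 2 ℤ.≤ + m
  2≤m {zero}        _   eq = contradiction (trans (ℕ.+-comm 1 d) eq) λ ()
  2≤m {suc zero}    2∣1 _  = contradiction 2∣1 (from-no (2 ∣? 1))
  2≤m {suc (suc m)} _   _  = ℤ.+≤+ (s≤s (s≤s z≤n))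
  mod4 : ∃ λ D → + d ≡ + 3 ℤ.+ + 4 ℤ.* D
  mod4 with l , m≡ ← even-ℕ m-even = l ℤ.* l ℤ.- ℤ.1ℤ , trans (lemma₁ (+ d)) (trans (cong (ℤ._- ℤ.1ℤ)
      (trans (cong +_ d≡) (trans (pos-^2 m) (cong₂ ℤ._*_ m≡ m≡)))) (lemma₂ l))
    where
    lemma₁ : ∀ d → d ≡ d ℤ.+ ℤ.1ℤ ℤ.- ℤ.1ℤ
    lemma₁ = solve-∀
    lemma₂ : ∀ l → (+ 2 ℤ.* l) ℤ.* (+ 2 ℤ.* l) ℤ.- ℤ.1ℤ ≡ + 3 ℤ.+ + 4 ℤ.* (l ℤ.* l ℤ.- ℤ.1ℤ)
    lemma₂ = solve-∀
type⇒reducible _ sf (inj₂ (inj₂ (inj₁ (m , m-odd , d≡)))) =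
  reducible-half sf m ℤ.-1ℤ (inj₁ (refl , odd⇒0< m-odd)) (d≡m²+k⇒m²≡d-k m 4 d≡)
type⇒reducible _ sf (inj₂ (inj₂ (inj₂ (m , _ , 3<m , d≡)))) =
  reducible-half sf m ℤ.1ℤ (inj₂ (refl , ℤ.+≤+ 3<m)) (d+k≡m²⇒m²≡d+k m 4 d≡)

-- Residues modulo 4 and the choice of m near √d.

residue-mod-4 : ∀ {d} → SquareFree d → TwoOrThreeMod4 d ⊎ (∃ λ D → d ≡ 1 ℕ.+ D ℕ.* 4)
residue-mod-4 {d} sf = go (d % 4) (m%n<n d 4) (m≡m%n+[m/n]*n d 4)
  where
  shape : ∀ e → d ≡ suc e ℕ.+ (d / 4) ℕ.* 4 → + d ≡ + suc e ℤ.+ + 4 ℤ.* + (d / 4)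
  shape e eq = trans (cong +_ (trans eq (cong (suc e ℕ.+_) (ℕ.*-comm (d / 4) 4))))
    (cong (λ x → + suc e ℤ.+ x) (ℤ.pos-* 4 (d / 4)))
  go : ∀ e → e ℕ.< 4 → d ≡ e ℕ.+ (d / 4) ℕ.* 4 → TwoOrThreeMod4 d ⊎ (∃ λ D → d ≡ 1 ℕ.+ D ℕ.* 4)
  go 0 _ eq = contradiction (sf 2 (divides (d / 4) eq)) λ ()
  go 1 _ eq = inj₂ (d / 4 , eq)
  go 2 _ eq = inj₁ (1 , + (d / 4) , inj₁ refl , shape 1 eq)
  go 3 _ eq = inj₁ (2 , + (d / 4) , inj₂ refl , shape 2 eq)
  go (suc (suc (suc (suc e)))) (s≤s (s≤s (s≤s (s≤s ())))) _

-- 2 (m² − d) + k² is at most 2km in absolute value.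
Near : ℕ → ℕ → ℕ → Set
Near d m k = 2 ℕ.* d ℕ.≤ 2 ℕ.* (m ℕ.* m) ℕ.+ k ℕ.* k ℕ.+ 2 ℕ.* (k ℕ.* m) ×
             2 ℕ.* (m ℕ.* m) ℕ.+ k ℕ.* k ℕ.≤ 2 ℕ.* d ℕ.+ 2 ℕ.* (k ℕ.* m)

≤-by : ∀ {a b} c → b ≡ a ℕ.+ c → a ℕ.≤ b
≤-by {a} c refl = ℕ.m≤m+n a c

-- The intervals from m² - m + 1 to m² + m tile the positive integers: the successor of m² + m is (m
-- + 1)² - (m + 1) + 1.
nearest-square : ∀ d → ∃ λ m → 1 ℕ.≤ m × suc d ℕ.≤ m ℕ.* m ℕ.+ m × m ℕ.* m ℕ.+ 1 ℕ.≤ suc d ℕ.+ m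
nearest-square zero    = 1 , s≤s z≤n , s≤s z≤n , s≤s (s≤s z≤n)
nearest-square (suc d) = go (nearest-square d)
  where
  upper : ∀ m → (1 ℕ.+ m) ℕ.* (1 ℕ.+ m) ℕ.+ (1 ℕ.+ m) ≡ 1 ℕ.+ (m ℕ.* m ℕ.+ m) ℕ.+ (1 ℕ.+ 2 ℕ.* m)
  upper = solve-∀ᴺ
  lower : ∀ m → (1 ℕ.+ m) ℕ.* (1 ℕ.+ m) ℕ.+ 1 ≡ 1 ℕ.+ (m ℕ.* m ℕ.+ m) ℕ.+ (1 ℕ.+ m)
  lower = solve-∀ᴺ
  step : ∀ m → 1 ℕ.≤ m → m ℕ.* m ℕ.+ 1 ℕ.≤ suc d ℕ.+ m →
    (suc d ℕ.< m ℕ.* m ℕ.+ m ⊎ suc d ≡ m ℕ.* m ℕ.+ m) →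
    ∃ λ m → 1 ℕ.≤ m × suc (suc d) ℕ.≤ m ℕ.* m ℕ.+ m × m ℕ.* m ℕ.+ 1 ℕ.≤ suc (suc d) ℕ.+ m
  step m 1≤m low (inj₁ d<) = m , 1≤m , d< , ℕ.m≤n⇒m≤1+n low
  step m 1≤m low (inj₂ d≡) = suc m , s≤s z≤n ,
    subst (λ x → suc x ℕ.≤ suc m ℕ.* suc m ℕ.+ suc m) (sym d≡) (≤-by (1 ℕ.+ 2 ℕ.* m) (upper m)) ,
    subst (λ x → suc m ℕ.* suc m ℕ.+ 1 ℕ.≤ suc x ℕ.+ suc m) (sym d≡) (ℕ.≤-reflexive (lower m))
  go : (∃ λ m → 1 ℕ.≤ m × suc d ℕ.≤ m ℕ.* m ℕ.+ m × m ℕ.* m ℕ.+ 1 ℕ.≤ suc d ℕ.+ m) →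
    ∃ λ m → 1 ℕ.≤ m × suc (suc d) ℕ.≤ m ℕ.* m ℕ.+ m × m ℕ.* m ℕ.+ 1 ℕ.≤ suc (suc d) ℕ.+ m
  go (m , 1≤m , up , low) = step m 1≤m low (ℕ.m≤n⇒m<n∨m≡n up)

square-root : ∀ D → ∃ λ r → r ℕ.* r ℕ.≤ D × D ℕ.≤ r ℕ.* r ℕ.+ 2 ℕ.* r
square-root zero    = 0 , z≤n , z≤n
square-root (suc D) = go (square-root D)
  where
  next : ∀ r → 1 ℕ.+ (r ℕ.* r ℕ.+ 2 ℕ.* r) ≡ (1 ℕ.+ r) ℕ.* (1 ℕ.+ r)
  next = solve-∀ᴺ
  step : ∀ r → r ℕ.* r ℕ.≤ D → (D ℕ.< r ℕ.* r ℕ.+ 2 ℕ.* r ⊎ D ≡ r ℕ.* r ℕ.+ 2 ℕ.* r) →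
    ∃ λ r → r ℕ.* r ℕ.≤ suc D × suc D ℕ.≤ r ℕ.* r ℕ.+ 2 ℕ.* r
  step r low (inj₁ D<) = r , ℕ.m≤n⇒m≤1+n low , D<
  step r low (inj₂ D≡) = suc r , ℕ.≤-reflexive (sym D+1≡) ,
    subst (λ x → x ℕ.≤ suc r ℕ.* suc r ℕ.+ 2 ℕ.* suc r) (sym D+1≡)
      (ℕ.m≤m+n (suc r ℕ.* suc r) (2 ℕ.* suc r))
    where
    D+1≡ : suc D ≡ suc r ℕ.* suc r
    D+1≡ = trans (cong suc D≡) (next r)
  go : (∃ λ r → r ℕ.* r ℕ.≤ D × D ℕ.≤ r ℕ.* r ℕ.+ 2 ℕ.* r) → ∃ λ r → r ℕ.* r ℕ.≤ suc D
    × suc D ℕ.≤ r ℕ.* r ℕ.+ 2 ℕ.* r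
  go (r , low , up) = step r low (ℕ.m≤n⇒m<n∨m≡n up)

near₁ : ∀ d → 1 ℕ.< d → ∃ λ m → 1 ℕ.≤ m × Near d m 1
near₁ (suc d) _ = go (nearest-square d)
  where
  open ℕ.≤-Reasoning
  go : (∃ λ m → 1 ℕ.≤ m × suc d ℕ.≤ m ℕ.* m ℕ.+ m × m ℕ.* m ℕ.+ 1 ℕ.≤ suc d ℕ.+ m) →
    ∃ λ m → 1 ℕ.≤ m × Near (suc d) m 1
  go (m , 1≤m , up , low) = m , 1≤m ,
    (begin
      2 ℕ.* suc d                                ≤⟨ ℕ.*-monoʳ-≤ 2 up ⟩
      2 ℕ.* (m ℕ.* m ℕ.+ m)                      ≤⟨ ≤-by 1 (lemma₁ m) ⟩
      2 ℕ.* (m ℕ.* m) ℕ.+ 1 ℕ.+ 2 ℕ.* (1 ℕ.* m)  ∎) ,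
    (begin
      2 ℕ.* (m ℕ.* m) ℕ.+ 1                      ≤⟨ ≤-by 1 (lemma₂ m) ⟩
      2 ℕ.* (m ℕ.* m ℕ.+ 1)                      ≤⟨ ℕ.*-monoʳ-≤ 2 low ⟩
      2 ℕ.* (suc d ℕ.+ m)                        ≡⟨ lemma₃ (suc d) m ⟩
      2 ℕ.* suc d ℕ.+ 2 ℕ.* (1 ℕ.* m)            ∎)
    where
    lemma₁ : ∀ m → 2 ℕ.* (m ℕ.* m) ℕ.+ 1 ℕ.+ 2 ℕ.* (1 ℕ.* m) ≡ 2 ℕ.* (m ℕ.* m ℕ.+ m) ℕ.+ 1
    lemma₁ = solve-∀ᴺ
    lemma₂ : ∀ m → 2 ℕ.* (m ℕ.* m ℕ.+ 1) ≡ 2 ℕ.* (m ℕ.* m) ℕ.+ 1 ℕ.+ 1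
    lemma₂ = solve-∀ᴺ
    lemma₃ : ∀ d m → 2 ℕ.* (d ℕ.+ m) ≡ 2 ℕ.* d ℕ.+ 2 ℕ.* (1 ℕ.* m)
    lemma₃ = solve-∀ᴺ

-- For m = 1 + 2r and d = 1 + 4D the two inequalities of `Near` amount to r² ≤ D ≤ (r + 1)², so r
-- can be the integer square root of D.
near₂ : ∀ D → ∃ λ r → Near (1 ℕ.+ D ℕ.* 4) (1 ℕ.+ 2 ℕ.* r) 2
near₂ D = go (square-root D)
  where
  open ℕ.≤-Reasoning
  go : (∃ λ r → r ℕ.* r ℕ.≤ D × D ℕ.≤ r ℕ.* r ℕ.+ 2 ℕ.* r) → ∃ λ r →
    Near (1 ℕ.+ D ℕ.* 4) (1 ℕ.+ 2 ℕ.* r) 2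
  go (r , low , up) = r ,
    (begin
      2 ℕ.* (1 ℕ.+ D ℕ.* 4)                          ≤⟨ ℕ.*-monoʳ-≤ 2 (ℕ.+-monoʳ-≤ 1 (ℕ.*-monoˡ-≤ 4 up))
        ⟩
      2 ℕ.* (1 ℕ.+ (r ℕ.* r ℕ.+ 2 ℕ.* r) ℕ.* 4)      ≤⟨ ≤-by 8 (lemma₁ r) ⟩
      2 ℕ.* (m r ℕ.* m r) ℕ.+ 4 ℕ.+ 2 ℕ.* (2 ℕ.* m r)  ∎) ,
    (begin
      2 ℕ.* (m r ℕ.* m r) ℕ.+ 4                      ≡⟨ lemma₂ r ⟩
      2 ℕ.* (1 ℕ.+ r ℕ.* r ℕ.* 4) ℕ.+ 2 ℕ.*
        (2 ℕ.* m r)  ≤⟨ ℕ.+-monoˡ-≤ (2 ℕ.* (2 ℕ.* m r))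
          (ℕ.*-monoʳ-≤ 2 (ℕ.+-monoʳ-≤ 1 (ℕ.*-monoˡ-≤ 4 low))) ⟩
      2 ℕ.* (1 ℕ.+ D ℕ.* 4) ℕ.+ 2 ℕ.* (2 ℕ.* m r)    ∎)
    where
    m : ℕ → ℕ
    m r = 1 ℕ.+ 2 ℕ.* r
    lemma₁ : ∀ r → 2 ℕ.* ((1 ℕ.+ 2 ℕ.* r) ℕ.* (1 ℕ.+ 2 ℕ.* r)) ℕ.+ 4 ℕ.+ 2 ℕ.* (2 ℕ.* (1 ℕ.+ 2 ℕ.* r))
      ≡ 2 ℕ.* (1 ℕ.+ (r ℕ.* r ℕ.+ 2 ℕ.* r) ℕ.* 4) ℕ.+ 8
    lemma₁ = solve-∀ᴺ
    lemma₂ : ∀ r → 2 ℕ.* ((1 ℕ.+ 2 ℕ.* r) ℕ.* (1 ℕ.+ 2 ℕ.* r)) ℕ.+ 4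
      ≡ 2 ℕ.* (1 ℕ.+ r ℕ.* r ℕ.* 4) ℕ.+ 2 ℕ.* (2 ℕ.* (1 ℕ.+ 2 ℕ.* r))
    lemma₂ = solve-∀ᴺ

-- 4k²m² - w² = (2km + w)(2km - w), and `Near` says that both factors are nonnegative.
near⇒w² : ∀ d m k → Near d m k → let m′ = fromℕ m; c = fromℕ k * fromℕ k; w = 2ℚ * (m′ * m′ - fromℕ d) + c in
  w * w ≤ 4ℚ * c * (m′ * m′)
near⇒w² d m k (up , low) = 0≤-⇒≤ (subst (0ℚ ≤_) (lemma (fromℕ d) (fromℕ m) (fromℕ k))
  (0≤* (≤⇒0≤- (subst₂ _≤_ (fromℕ-homo-* 2 d)
    (trans (fromℕ-homo-+ (2 ℕ.* (m ℕ.* m) ℕ.+ k ℕ.* k) (2 ℕ.* (k ℕ.* m))) (cong₂ _+_ m²+k² 2km))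
      (fromℕ-mono-≤ up)))
       (≤⇒0≤- (subst₂ _≤_ m²+k² (trans (fromℕ-homo-+ (2 ℕ.* d) (2 ℕ.* (k ℕ.* m)))
         (cong₂ _+_ (fromℕ-homo-* 2 d) 2km)) (fromℕ-mono-≤ low)))))
  where
  fromℕ-mono-≤ : ∀ {i j} → i ℕ.≤ j → fromℕ i ≤ fromℕ j
  fromℕ-mono-≤ {i} {j} p = fromℤ-mono-≤ {+ i} {+ j} (ℤ.+≤+ p)
  2km : fromℕ (2 ℕ.* (k ℕ.* m)) ≡ 2ℚ * (fromℕ k * fromℕ m)
  2km = trans (fromℕ-homo-* 2 (k ℕ.* m)) (cong (2ℚ *_) (fromℕ-homo-* k m))
  m²+k² : fromℕ (2 ℕ.* (m ℕ.* m) ℕ.+ k ℕ.* k) ≡ 2ℚ * (fromℕ m * fromℕ m) + fromℕ k * fromℕ k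
  m²+k² = trans (fromℕ-homo-+ (2 ℕ.* (m ℕ.* m)) (k ℕ.* k)) (cong₂ _+_
    (trans (fromℕ-homo-* 2 (m ℕ.* m)) (cong (2ℚ *_) (fromℕ-homo-* m m))) (fromℕ-homo-* k k))
  lemma : ∀ d m k → (2ℚ * (m * m) + k * k + 2ℚ * (k * m) - 2ℚ * d) *
    (2ℚ * d + 2ℚ * (k * m) - (2ℚ * (m * m) + k * k))
    ≡ 4ℚ * (k * k) * (m * m) - (2ℚ * (m * m - d) + k * k) * (2ℚ * (m * m - d) + k * k)
  lemma = solve 3 (λ d m k → (con 2ℚ :* (m :* m) :+ k :* k :+ con 2ℚ :* (k :* m) :- con 2ℚ :* d) :*
    (con 2ℚ :* d :+ con 2ℚ :* (k :* m) :- (con 2ℚ :* (m :* m) :+ k :* k)) := con 4ℚ :* (k :* k) :*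
    (m :* m) :- (con 2ℚ :* (m :* m :- d) :+ k :* k) :* (con 2ℚ :* (m :* m :- d) :+ k :* k)) refl

-- The right-hand side is the coefficient `T` of the test element, whose positivity
-- `totallyPositive` requires.
0<middle : ∀ d m k → k ℕ.* k ℕ.< m ℕ.* m ℕ.+ m ℕ.* m ℕ.+ (d ℕ.+ d) →
  0ℚ < fromℕ m * fromℕ m + fromℕ m * fromℕ m + (fromℕ d + fromℕ d) - fromℕ k * fromℕ k
0<middle d m k lt = <⇒0<- (subst₂ _<_ (fromℕ-homo-* k k)
  (trans (fromℕ-homo-+ (m ℕ.* m ℕ.+ m ℕ.* m) (d ℕ.+ d)) (cong₂ _+_
    (trans (fromℕ-homo-+ (m ℕ.* m) (m ℕ.* m)) (cong₂ _+_ (fromℕ-homo-* m m) (fromℕ-homo-* m m)))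
    (fromℕ-homo-+ d d)))
  (fromℤ-mono-< {+ (k ℕ.* k)} {+ (m ℕ.* m ℕ.+ m ℕ.* m ℕ.+ (d ℕ.+ d))} (ℤ.+<+ lt)))

-- Necessity: the norm equation and the resulting types.

quadratic-integral : ∀ {d} r s t n → 2ℚ * r ≡ fromℤ t → r * r - fromℕ d * (s * s) ≡ fromℤ n →
  Integral {d} ⟨ r , s ⟩
quadratic-integral r s t n trace-eq norm-eq = ℤ[ε]⇒integral r s t n trace-eq norm-eq
  (0ℚ , 1ℚ , integer-fromℤ ℤ.0ℤ , integer-fromℤ ℤ.1ℤ ,
    cong₂ ⟨_,_⟩ (sym (trans (+-identityˡ (1ℚ * r)) (*-identityˡ r))) (sym (*-identityˡ s)))

abs-square : ∀ i → + ℤ.∣ i ∣ ℤ.* + ℤ.∣ i ∣ ≡ i ℤ.* i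
abs-square (+ n)       = refl
abs-square ℤ.-[1+ n ]  = refl

m²≡d+k⇒d+k≡m² : ∀ {d} m k → + m ℤ.* + m ≡ + d ℤ.+ + k → d ℕ.+ k ≡ m ℕ.^ 2
m²≡d+k⇒d+k≡m² m k eq = ℤ.+-injective (trans (sym eq) (sym (pos-^2 m)))

m²≡d-k⇒d≡m²+k : ∀ {d} m k → + m ℤ.* + m ≡ + d ℤ.- + k → d ≡ m ℕ.^ 2 ℕ.+ k
m²≡d-k⇒d≡m²+k {d} m k eq = ℤ.+-injective
  (trans (lemma (+ d) (+ k)) (cong (ℤ._+ + k) (trans (sym eq) (sym (pos-^2 m)))))
  where
  lemma : ∀ d k → d ≡ d ℤ.- k ℤ.+ k
  lemma = solve-∀

NormEquation : ℕ → ℕ → Set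
NormEquation d k = ∃₂ λ M n → PlusMinusOne n × M ℤ.* M ≡ + d ℤ.+ + k ℤ.* + k ℤ.* n

-- Already 2d ≥ 4 ≥ k², and m ≥ 1 makes the inequality strict.
k²<2m²+2d : ∀ {d m k} → 1 ℕ.≤ m → 1 ℕ.< d → k ℕ.≤ 2 → k ℕ.* k ℕ.< m ℕ.* m ℕ.+ m ℕ.* m ℕ.+ (d ℕ.+ d)
k²<2m²+2d 1≤m 1<d k≤2 = ℕ.≤-<-trans (ℕ.*-mono-≤ k≤2 k≤2)
  (ℕ.+-mono-≤ {1} (ℕ.+-mono-≤ {1} {_} {0} (ℕ.*-mono-≤ 1≤m 1≤m) z≤n) (ℕ.+-mono-≤ 1<d 1<d))

norm-equation₁ : ∀ {d} → 1 ℕ.< d → SquareFree d → TwoOrThreeMod4 d → UnitReducible d → NormEquation d 1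
norm-equation₁ {d} 1<d sf mod4 reducible = go (near₁ d 1<d)
  where
  go : (∃ λ m → 1 ℕ.≤ m × Near d m 1) → NormEquation d 1
  go (m , 1≤m , near) = reducible⇒norm-equation {d} {m} {1} {{ℕ.>-nonZero (ℕ.<-trans (s≤s z≤n) 1<d)}}
    {{ℕ.>-nonZero 1≤m}}
    ⟨ fromℕ m , 1ℚ ⟩ (*-identityˡ (fromℕ m)) refl
    (quadratic-integral (fromℕ m) 1ℚ (+ 2 ℤ.* + m) n₁ (trace₁ m n₁ m²≡) (norm₁ m n₁ m²≡))
    (λ x x∈O → whole-coordinates mod4 x (integral⇒coordinates sf x∈O))
    (0<middle d m 1 (k²<2m²+2d 1≤m 1<d (s≤s z≤n))) (near⇒w² d m 1 near) reducible
    where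
    n₁ = + m ℤ.* + m ℤ.- + d
    m²≡ : + m ℤ.* + m ≡ + d ℤ.+ n₁
    m²≡ = lemma (+ m ℤ.* + m) (+ d)
      where
      lemma : ∀ x d → x ≡ d ℤ.+ (x ℤ.- d)
      lemma = solve-∀

norm-equation₂ : ∀ {d} → 1 ℕ.< d → SquareFree d → (∃ λ D → d ≡ 1 ℕ.+ D ℕ.* 4) → UnitReducible d →
  NormEquation d 2
norm-equation₂ 1<d sf (D , refl) reducible = go (near₂ D)
  where
  go : (∃ λ r → Near (1 ℕ.+ D ℕ.* 4) (1 ℕ.+ 2 ℕ.* r) 2) → NormEquation (1 ℕ.+ D ℕ.* 4) 2
  go (r , near) = reducible⇒norm-equation {1 ℕ.+ D ℕ.* 4} {m} {2}
    ⟨ ½ * fromℕ m , ½ ⟩ (trace₂ {1 ℕ.+ D ℕ.* 4} m n₁ m²≡) refl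
    (quadratic-integral (½ * fromℕ m) ½ (+ m) n₁ (trace₂ {1 ℕ.+ D ℕ.* 4} m n₁ m²≡) (norm₂ m n₁ m²≡))
    (λ x x∈O → integral⇒coordinates sf x∈O)
    (0<middle (1 ℕ.+ D ℕ.* 4) m 2 (k²<2m²+2d {1 ℕ.+ D ℕ.* 4} {m} {2} (s≤s z≤n) 1<d ℕ.≤-refl))
    (near⇒w² (1 ℕ.+ D ℕ.* 4) m 2 near) reducible
    where
    m = 1 ℕ.+ 2 ℕ.* r
    -- This is (m² - d)/4, the norm of x₀ = (m + √d)/2.
    n₁ = + r ℤ.* + r ℤ.+ + r ℤ.- + D
    m²≡ : + m ℤ.* + m ≡ + (1 ℕ.+ D ℕ.* 4) ℤ.+ + 2 ℤ.* + 2 ℤ.* n₁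
    m²≡ = trans (cong (λ x → (+ 1 ℤ.+ x) ℤ.* (+ 1 ℤ.+ x)) (ℤ.pos-* 2 r)) (trans (lemma (+ r) (+ D))
      (cong (λ x → + 1 ℤ.+ x ℤ.+ + 2 ℤ.* + 2 ℤ.* n₁) (sym (ℤ.pos-* D 4))))
      where
      lemma : ∀ r D → (+ 1 ℤ.+ + 2 ℤ.* r) ℤ.* (+ 1 ℤ.+ + 2 ℤ.* r)
        ≡ + 1 ℤ.+ D ℤ.* + 4 ℤ.+ + 2 ℤ.* + 2 ℤ.* (r ℤ.* r ℤ.+ r ℤ.- D)
      lemma = solve-∀

-- The parity of m follows modulo 4: d = m² - 1 with m odd would give d ≡ 0, and d = m² + 1 with m
-- even would give d ≡ 1.
norm-equation⇒type₁ : ∀ {d} → TwoOrThreeMod4 d → NormEquation d 1 → UnitReducibleType d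
norm-equation⇒type₁ {d} (e , D , e≡ , d≡) (M , n , ±1 , M²≡) = go ±1 (trans (abs-square M) M²≡)
  where
  m = ℤ.∣ M ∣
  go : PlusMinusOne n → + m ℤ.* + m ≡ + d ℤ.+ + 1 ℤ.* + 1 ℤ.* n → UnitReducibleType d
  go (inj₁ refl) eq = inj₂ (inj₁ (m , even (2 ∣? m) , m²≡d+k⇒d+k≡m² m 1 eq))
    where
    lemma : ∀ l e D → + 4 ℤ.* (l ℤ.* l ℤ.+ l ℤ.- D) ≡
      e ℤ.+ ((+ 2 ℤ.* l ℤ.+ + 1) ℤ.* (+ 2 ℤ.* l ℤ.+ + 1) ℤ.- (e ℤ.+ + 4 ℤ.* D ℤ.+ + 1))
    lemma = solve-∀
    odd-absurd : (∃ λ l → + m ≡ + 2 ℤ.* l ℤ.+ + 1) → 4 ∣ suc e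
    odd-absurd (l , m≡) = ≡-mod⇒∣ 4 _ (+ suc e) (lemma l (+ suc e) D)
      (trans (cong₂ ℤ._*_ (sym m≡) (sym m≡)) (trans eq (cong (ℤ._+ + 1) d≡)))
    even : Dec (2 ∣ m) → 2 ∣ m
    even (yes p) = p
    even (no ¬p) = contradiction (odd-absurd (odd-ℕ m ¬p)) (¬4∣suc e≡)
  go (inj₂ refl) eq = inj₁ (m , (λ 2∣m → ¬4∣ e≡ (even-absurd (even-ℕ 2∣m))) , m²≡d-k⇒d≡m²+k m 1 eq)
    where
    lemma : ∀ l e D → + 4 ℤ.* (l ℤ.* l ℤ.- D) ≡
      e ℤ.+ ((+ 2 ℤ.* l) ℤ.* (+ 2 ℤ.* l) ℤ.- (+ 1 ℤ.+ e ℤ.+ + 4 ℤ.* D ℤ.+ ℤ.-1ℤ))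
    lemma = solve-∀
    even-absurd : (∃ λ l → + m ≡ + 2 ℤ.* l) → 4 ∣ e
    even-absurd (l , m≡) = ≡-mod⇒∣ 4 _ (+ e) (lemma l (+ e) D)
      (trans (cong₂ ℤ._*_ (sym m≡) (sym m≡)) (trans eq (cong (ℤ._+ ℤ.-1ℤ) d≡)))

-- Since d ≡ 1 modulo 4, M² = d ± 4 is odd, so m = |M| is odd for both signs. For d = m² - 4 the
-- small values of m remain to be sorted out.
norm-equation⇒type₂ : ∀ {d} → 1 ℕ.< d → (∃ λ D → d ≡ 1 ℕ.+ D ℕ.* 4) → NormEquation d 2 →
  UnitReducibleType d
norm-equation⇒type₂ {d} 1<d (D , d≡) (M , n , ±1 , M²≡) = go ±1 (trans (abs-square M) M²≡)
  where
  m-odd : ∀ {m} → + m ℤ.* + m ≡ + d ℤ.+ + 2 ℤ.* + 2 ℤ.* n → ¬ (2 ∣ m)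
  m-odd {m} eq 2∣m = contradiction (even-absurd (even-ℕ 2∣m)) (from-no (4 ∣? 1))
    where
    lemma : ∀ l n D → + 4 ℤ.* (l ℤ.* l ℤ.- D ℤ.- n) ≡
      + 1 ℤ.+ ((+ 2 ℤ.* l) ℤ.* (+ 2 ℤ.* l) ℤ.- (+ 1 ℤ.+ D ℤ.* + 4 ℤ.+ + 2 ℤ.* + 2 ℤ.* n))
    lemma = solve-∀
    even-absurd : (∃ λ l → + m ≡ + 2 ℤ.* l) → 4 ∣ 1
    even-absurd (l , m≡) = ≡-mod⇒∣ 4 _ (+ 1) (lemma l n (+ D))
      (trans (cong₂ ℤ._*_ (sym m≡) (sym m≡)) (trans eq (cong (ℤ._+ + 2 ℤ.* + 2 ℤ.* n)
        (trans (cong +_ d≡) (cong (λ x → + 1 ℤ.+ x) (ℤ.pos-* D 4))))))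

  large : ∀ m → ¬ (2 ∣ m) → d ℕ.+ 4 ≡ m ℕ.^ 2 → UnitReducibleType d
  large zero                   odd _  = contradiction (divides 0 refl) odd
  large (suc zero)             _   eq = contradiction (subst (4 ℕ.≤_) eq (ℕ.m≤n+m 4 d)) λ { (s≤s ()) }
  large (suc (suc zero))       odd _  = contradiction (divides 1 refl) odd
  -- 5 = 3² − 4 is of the excluded form but also equals 1² + 4.
  large (suc (suc (suc zero))) _   eq =
    inj₂ (inj₂ (inj₁ (1 , from-no (2 ∣? 1) , ℕ.+-cancelʳ-≡ 4 d 5 eq)))
  large m@(suc (suc (suc (suc _)))) odd eq =
    inj₂ (inj₂ (inj₂ (m , odd , s≤s (s≤s (s≤s (s≤s z≤n))) , eq)))

  go : PlusMinusOne n → + ℤ.∣ M ∣ ℤ.* + ℤ.∣ M ∣ ≡ + d ℤ.+ + 2 ℤ.* + 2 ℤ.* n → UnitReducibleType d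
  go ±1 eq with m-odd {ℤ.∣ M ∣} eq
  go (inj₁ refl) eq | odd = large ℤ.∣ M ∣ odd (m²≡d+k⇒d+k≡m² ℤ.∣ M ∣ 4 eq)
  go (inj₂ refl) eq | odd = inj₂ (inj₂ (inj₁ (ℤ.∣ M ∣ , odd , m²≡d-k⇒d≡m²+k ℤ.∣ M ∣ 4 eq)))

reducible⇒type : ∀ {d} → 1 ℕ.< d → SquareFree d → UnitReducible d → UnitReducibleType d
reducible⇒type 1<d sf reducible =
  [ (λ mod4 → norm-equation⇒type₁ mod4 (norm-equation₁ 1<d sf mod4 reducible))
  , (λ mod4 → norm-equation⇒type₂ 1<d mod4 (norm-equation₂ 1<d sf mod4 reducible))
  ]′ (residue-mod-4 sf)

theorem4 : (d : ℕ) → 1 ℕ.< d → SquareFree d →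
    UnitReducible d ⇔
    ( (∃ λ m → ¬ (2 ∣ m) × d ≡ m ℕ.^ 2 ℕ.+ 1)
    ⊎ (∃ λ m → 2 ∣ m × d ℕ.+ 1 ≡ m ℕ.^ 2)
    ⊎ (∃ λ m → ¬ (2 ∣ m) × d ≡ m ℕ.^ 2 ℕ.+ 4)
    ⊎ (∃ λ m → ¬ (2 ∣ m) × 3 ℕ.< m × d ℕ.+ 4 ≡ m ℕ.^ 2) )
theorem4 d 1<d sf = mk⇔ (reducible⇒type 1<d sf) (type⇒reducible 1<d sf)
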